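{- Let $v_0$ be the Fibonacci word and $F_k$ the Fibonacci numbers (see context). Let $n\ge2$ and write $n=F_k+j$ with $k\ge2$ and $0\le j\le F_{k-1}-1$. For $i\in\mathbf{N}$ let $w_i=(v_0(i),v_0(i+1),\dots,v_0(i+n-1))$. Define $A_n=\{w_{1+m}:0\le m\le F_{k-1}-j-2\}$, $B_n=\{w_{F_{k-1}-j+m}:0\le m\le F_{k-2}+j\}$, $C_n=\{w_{F_{k+1}-j+m}:0\le m\le j\}$. Then: (a) $P_n=A_n\cup B_n\cup C_n$, and this union is disjoint; (b) $w_{F_k+1+m}=w_{1+m}$ for $0\le m\le F_{k-1}-j-2$; $A_n$ is exactly the set of words of length $n$ occurring as factors of $(v_0(1),\dots,v_0(F_{k+1}-2))$; among $w_1,\dots,w_{F_{k+1}}$ (the length-$n$ windows of $(v_0(1),\dots,v_0(f(n)))$, where $f(n)=F_{k+2}+j-1$), each word of $A_n$ occurs exactly twice and each word of $B_n\cup C_n$ exactly once; these windows run through $A_n$ (as $w_1,\dots,w_{F_{k-1}-j-1}$), then $B_n$, then $A_n$ again (as $w_{F_k+1},\dots,w_{F_{k+1}-j-1}$), then $C_n$; (c) $|A_n|=F_{k-1}-j-1$, and for each $w\in A_n$, any two consecutive occurrences of $w$ in $v_0$ (at positions $i<i'$ with no occurrence strictly between) overlap in $j$ or in $F_{k-2}+j$ letters, i.e. $i'-i\in\{n-j,\ n-F_{k-2}-j\}$; (d) $|B_n|=F_{k-2}+j+1$, and for each $w\in B_n$ consecutive occurrences overlap in $j$ letters or are separated by a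 gap of $F_{k-1}-j$ letters, i.e. $i'-i\in\{n-j,\ n+F_{k-1}-j\}$; (e) $|C_n|=j+1$, and for each $w\in C_n$ consecutive occurrences are separated by a gap of $F_{k-1}-j$ or $F_{k+1}-j$ letters, i.e. $i'-i\in\{n+F_{k-1}-j,\ n+F_{k+1}-j\}$.
   Context: Let $\tau=\frac{1+\sqrt5}{2}$, $\alpha=1/\tau$, and let $v_0\in\{0,1\}^{\mathbf{Z}}$, $v_0(n)=1_{[1-\alpha,1)}(n\alpha\bmod 1)$ (the Fibonacci word; $(v_0(1),v_0(2),\dots)=1011010110110\dots$). Fibonacci numbers: $F_0=1$, $F_1=1$, $F_2=2$, $F_{k+1}=F_k+F_{k-1}$. $P_n$ denotes the set of words of length $n$ occurring as factors (blocks of consecutive letters) of $v_0$, and $f(n)$ the smallest $N$ such that every word of $P_n$ occurs as a factor of $(v_0(1),\dots,v_0(N))$. -}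

module Defs where

open import Data.Nat as ℕ using (ℕ; zero; suc; _+_; _*_; _∸_; _^_; _≤_; _<_; _≤ᵇ_)
open import Data.Integer as ℤ using (ℤ; +_; -[1+_])
open import Data.Bool using (Bool; true; false; if_then_else_)
open import Data.Fin using (Fin; toℕ)
open import Data.Vec using (Vec; tabulate)
open import Data.Vec.Properties using (≡-dec)
open import Data.List using (List; length; filter; upTo; map)
open import Data.List.Membership.Propositional using (_∈_)
open import Data.List.Relation.Unary.Unique.Propositional using (Unique)
open import Data.Product using (Σ; ∃; _×_; _,_)
open import Function.Bundles using (_⇔_)
open import Relation.Nullary.Decidable using (⌊_⌋)
open import Relation.Binary.PropositionalEquality using (_≡_)

F : ℕ → ℕ
F zero = 1
F (suc zero) = 1
F (suc (suc k)) = F (suc k) + F k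

-- flα n = ⌊ n α ⌋ for n : ℕ, α = (√5 - 1)/2 :
-- the largest m ≤ n with m ≤ n α, i.e. (2m + n)² ≤ 5 n².
flα-go : ℕ → ℕ → ℕ
flα-go n zero = zero
flα-go n (suc m) =
  if ((2 * suc m + n) ^ 2) ≤ᵇ (5 * n ^ 2) then suc m else flα-go n m

flα : ℕ → ℕ
flα n = flα-go n n

-- ⌊ z α ⌋ for z : ℤ  (for x > 0, ⌊ -x α ⌋ = - ⌊ x α ⌋ - 1 since x α ∉ ℤ).
floorα : ℤ → ℤ
floorα (+ n) = + flα n
floorα (-[1+ k ]) = -[1+ flα (suc k) ]

-- The Fibonacci word v₀(z) = 1_{[1-α,1)}(z α mod 1), z ∈ ℤ.
-- {z α} ≥ 1 - α  iff  ⌊ (z+1) α ⌋ = ⌊ z α ⌋ + 1  iff  ⌊ z α ⌋ < ⌊ (z+1) α ⌋.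
v₀ : ℤ → ℕ
v₀ z = if ⌊ floorα z ℤ.<? floorα (z ℤ.+ ℤ.1ℤ) ⌋ then 1 else 0

win : (n : ℕ) → ℤ → Vec ℕ n
win n z = tabulate (λ t → v₀ (z ℤ.+ + toℕ t))

w : (n : ℕ) → ℕ → Vec ℕ n
w n i = win n (+ i)

OccursAt : {n : ℕ} → Vec ℕ n → ℤ → Set
OccursAt {n} u z = win n z ≡ u

InP : (n : ℕ) → Vec ℕ n → Set
InP n u = ∃ λ z → OccursAt u z

FactorOfPrefix : {n : ℕ} → ℕ → Vec ℕ n → Set
FactorOfPrefix {n} N u = Σ ℕ λ i → 1 ≤ i × i + n ∸ 1 ≤ N × w n i ≡ u

CoversP : ℕ → ℕ → Set
CoversP n N = ∀ (u : Vec ℕ n) → InP n u → FactorOfPrefix N u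

IsF : ℕ → ℕ → Set
IsF n N = CoversP n N × (∀ N′ → CoversP n N′ → N ≤ N′)

count : (n N : ℕ) → Vec ℕ n → ℕ
count n N u = length (filter (λ i → ≡-dec ℕ._≟_ (w n i) u) (map suc (upTo N)))

HasCard : {n : ℕ} → (Vec ℕ n → Set) → ℕ → Set
HasCard {n} P c = Σ (List (Vec ℕ n)) λ L → Unique L × length L ≡ c × (∀ u → (u ∈ L) ⇔ P u)

Consecutive : {n : ℕ} → Vec ℕ n → ℤ → ℤ → Set
Consecutive u i i′ =
  i ℤ.< i′ × OccursAt u i × OccursAt u i′ × (∀ p → i ℤ.< p → p ℤ.< i′ → OccursAt u p → Data.Empty.⊥)
  where import Data.Empty

InA : (n k j : ℕ) → Vec ℕ n → Set
InA n k j u = Σ ℕ λ m → m + j + 2 ≤ F (k ∸ 1) × w n (1 + m) ≡ u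

InB : (n k j : ℕ) → Vec ℕ n → Set
InB n k j u = Σ ℕ λ m → m ≤ F (k ∸ 2) + j × w n (F (k ∸ 1) ∸ j + m) ≡ u

InC : (n k j : ℕ) → Vec ℕ n → Set
InC n k j u = Σ ℕ λ m → m ≤ j × w n (F (suc k) ∸ j + m) ≡ u

{-# OPTIONS --safe #-}
-- Write x(z) = z α mod 1 and let μ l z = (-1)^l (⌊(z + F l) α⌋ − ⌊z α⌋ − F (l − 1)). Since F l · α differs
-- from the integer F (l − 1) by α^(l+1) with sign (-1)^l, μ l is the indicator function of a set M l ⊂ ℤ,
-- namely the set where x lies in an interval of length α^(l+1) at one end of [0,1). Splitting
-- ⌊(z + F l + F (l+1)) α⌋ − ⌊z α⌋ in both orders gives
--   μ l z = μ (l+2) z + μ (l+1) (z + F l),   μ l (z + F (l+1)) = μ (l+2) z + μ (l+1) z,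
-- and from these identities and the first letters of v₀: consecutive elements of M l differ by F (l+1) or F (l+2); the only
-- element of M l in [1, F (l+3)) is F (l+1); around every element of M l the word v₀ shows the same
-- F (l+3) − 2 letters. Conversely μ l z depends only on the F l letters of v₀ from z on, as ⌊z α⌋
-- increases by v₀ z from z to z + 1. So for k = l + 2 the words of A, B and C are those whose
-- occurrences form a translate of M l, M (l+1) and M (l+2), respectively.
module Submission where

open import Defs
open import Data.Bool using (true; false; T)
open import Data.Fin using (Fin; toℕ; fromℕ<)
import Data.Fin.Properties as Finₚ
open import Data.Integer as ℤ using (ℤ; +_; -[1+_]; 0ℤ; 1ℤ; -1ℤ)
import Data.Integer.Properties as ℤₚ
import Data.Integer.Tactic.RingSolver as ℤ-Solver
open import Data.List using ([]; _∷_; _++_; length; filter; map; upTo; tabulate)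
open import Data.List.Membership.Propositional using (_∈_)
open import Data.List.Membership.Propositional.Properties using (∈-tabulate⁺; ∈-tabulate⁻)
open import Data.List.Properties
  using (filter-accept; filter-reject; filter-++; length-++; map-++; upTo-∷ʳ; length-tabulate)
open import Data.List.Relation.Unary.Unique.Propositional.Properties using (tabulate⁺)
open import Data.Nat as ℕ using (ℕ; zero; suc; _+_; _*_; _∸_; _^_; _≤_; _<_; _≤ᵇ_; z≤n; s≤s; z<s)
open import Data.Nat.Properties
import Data.Nat.Tactic.RingSolver as ℕ-Solver
open import Data.Product using (_×_; _,_; proj₁; proj₂; ∃)
open import Data.Sum as Sum using (_⊎_; inj₁; inj₂; [_,_]′)
open import Data.Unit using (tt)
open import Data.Vec using (Vec; lookup)
open import Data.Vec.Properties using (≡-dec; lookup∘tabulate; tabulate-cong)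
open import Function using (_∘_; id)
open import Function.Bundles using (_⇔_; mk⇔)
open import Relation.Binary.Definitions using (tri<; tri≈; tri>)
open import Relation.Binary.PropositionalEquality
open import Relation.Nullary using (¬_; yes; no; contradiction)

-- The floor of z α

-- Farkas-style certificate: the slack d and a ring identity derive x ≤ y from a ≤ b.
≤-certificate : ∀ d {a b x y} → a ≤ b → x + b + d ≡ y + a → x ≤ y
≤-certificate d {a} {b} {x} {y} a≤b eq = +-cancelʳ-≤ b x y (begin
  x + b      ≤⟨ m≤m+n (x + b) d ⟩
  x + b + d  ≡⟨ eq ⟩
  y + a      ≤⟨ +-monoʳ-≤ y a≤b ⟩
  y + b      ∎)
  where open ≤-Reasoning

sqrt-mono-≤ : ∀ {a b} → a * a ≤ b * b → a ≤ b
sqrt-mono-≤ a²≤b² = ≮⇒≥ λ b<a → <⇒≱ (*-mono-< b<a b<a) a²≤b²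

sqrt-mono-< : ∀ {a b} → a * a < b * b → a < b
sqrt-mono-< a²<b² = ≰⇒> λ b≤a → <⇒≱ a²<b² (*-mono-≤ b≤a b≤a)

-- m ≤ n α, with the square root cleared
Below : ℕ → ℕ → Set
Below m n = (2 * m + n) * (2 * m + n) ≤ 5 * (n * n)

Above : ℕ → ℕ → Set
Above m n = 5 * (n * n) < (2 * m + n) * (2 * m + n)

*-square : ∀ x y → x * x * (y * y) ≡ x * y * (x * y)
*-square = ℕ-Solver.solve-∀

5*-square : ∀ x y → 5 * (x * x) * (5 * (y * y)) ≡ 5 * (x * y) * (5 * (x * y))
5*-square = ℕ-Solver.solve-∀

-- `Below m n` says m ≤ n α, so over the reals the sum is clear. Over ℕ the square of the sum leaves
-- the cross term `x * x′`, bounded by the square root of the product of the two hypotheses.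
Below-+ : ∀ {m n m′ n′} → Below m n → Below m′ n′ → Below (m + m′) (n + n′)
Below-+ {m} {n} {m′} {n′} p q =
  ≤-certificate 0 (+-mono-≤ (+-mono-≤ p q) (+-mono-≤ cross cross)) (expand m n m′ n′)
  where
  x = 2 * m + n
  x′ = 2 * m′ + n′
  cross : x * x′ ≤ 5 * (n * n′)
  cross = sqrt-mono-≤ (subst₂ _≤_ (*-square x x′) (5*-square n n′)
            (*-mono-≤ {x * x} {5 * (n * n)} {x′ * x′} {5 * (n′ * n′)} p q))
  expand : ∀ m n m′ n′ →
    (2 * (m + m′) + (n + n′)) * (2 * (m + m′) + (n + n′))
      + (5 * (n * n) + 5 * (n′ * n′) + (5 * (n * n′) + 5 * (n * n′))) + 0
    ≡ 5 * ((n + n′) * (n + n′))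
      + ((2 * m + n) * (2 * m + n) + (2 * m′ + n′) * (2 * m′ + n′)
         + ((2 * m + n) * (2 * m′ + n′) + (2 * m + n) * (2 * m′ + n′)))
  expand = ℕ-Solver.solve-∀

Above-+ : ∀ {m n m′ n′} → Above m n → Above m′ n′ → Above (m + m′) (n + n′)
Above-+ {m} {n} {m′} {n′} p q =
  -- Four strict inequalities are added and one is to be shown, which leaves a slack of 3.
  ≤-certificate 3 (+-mono-≤ (+-mono-≤ p q) (+-mono-≤ cross cross)) (expand m n m′ n′)
  where
  x = 2 * m + n
  x′ = 2 * m′ + n′
  cross : 5 * (n * n′) < x * x′
  cross = sqrt-mono-< (subst₂ _<_ (5*-square n n′) (*-square x x′)
            (*-mono-< {5 * (n * n)} {x * x} {5 * (n′ * n′)} {x′ * x′} p q))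
  expand : ∀ m n m′ n′ →
    1 + 5 * ((n + n′) * (n + n′))
      + ((2 * m + n) * (2 * m + n) + (2 * m′ + n′) * (2 * m′ + n′)
         + ((2 * m + n) * (2 * m′ + n′) + (2 * m + n) * (2 * m′ + n′))) + 3
    ≡ (2 * (m + m′) + (n + n′)) * (2 * (m + m′) + (n + n′))
      + ((1 + 5 * (n * n)) + (1 + 5 * (n′ * n′)) + ((1 + 5 * (n * n′)) + (1 + 5 * (n * n′))))
  expand = ℕ-Solver.solve-∀

-- Since √5 < 3. Every candidate `m` therefore lies in the range that `flα` searches.
Below⇒≤ : ∀ {m n} → Below m n → m ≤ n
Below⇒≤ {m} {n} p = *-cancelˡ-≤ 2 (+-cancelʳ-≤ n (2 * m) (2 * n) (sqrt-mono-≤ (≤-trans p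
  (≤-certificate (4 * (n * n)) (z≤n {0}) (expand n)))))
  where
  expand : ∀ n → 5 * (n * n) + 0 + 4 * (n * n) ≡ (2 * n + n) * (2 * n + n) + 0
  expand = ℕ-Solver.solve-∀

square : ∀ x → x ^ 2 ≡ x * x
square x = cong (x *_) (*-identityʳ x)

flα-go-Below : ∀ n m → Below (flα-go n m) n
flα-go-Below n zero = m≤n*m (n * n) 5
flα-go-Below n (suc m) with ((2 * suc m + n) ^ 2) ≤ᵇ (5 * n ^ 2) in eq
... | true  = subst₂ _≤_ (square (2 * suc m + n)) (cong (5 *_) (square n)) (≤ᵇ⇒≤ _ _ (subst T (sym eq) tt))
... | false = flα-go-Below n m

flα-go-greatest : ∀ n m {m′} → m′ ≤ m → Below m′ n → m′ ≤ flα-go n m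
flα-go-greatest n zero m′≤m _ = m′≤m
flα-go-greatest n (suc m) {m′} m′≤m p with ((2 * suc m + n) ^ 2) ≤ᵇ (5 * n ^ 2) in eq
... | true  = m′≤m
... | false = flα-go-greatest n m (≤-pred (≤∧≢⇒< m′≤m λ { refl → subst T eq (≤⇒≤ᵇ
                (subst₂ _≤_ (sym (square (2 * suc m + n))) (cong (5 *_) (sym (square n))) p)) })) p

flα-Below : ∀ n → Below (flα n) n
flα-Below n = flα-go-Below n n

flα-greatest : ∀ {m} n → Below m n → m ≤ flα n
flα-greatest n p = flα-go-greatest n n (Below⇒≤ p) p

flα-Above : ∀ n → Above (suc (flα n)) n
flα-Above n = ≰⇒> λ p → <-irrefl refl (flα-greatest n p)

Above⇒flα< : ∀ {m n} → Above m n → flα n < m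
Above⇒flα< {m} {n} p = ≰⇒> λ m≤fl → <⇒≱ p (≤-trans (*-mono-≤ (mono m≤fl) (mono m≤fl)) (flα-Below n))
  where
  mono : m ≤ flα n → 2 * m + n ≤ 2 * flα n + n
  mono h = +-monoˡ-≤ n (*-monoʳ-≤ 2 h)

flα-+ : ∀ y z → flα (y + z) ≡ flα y + flα z ⊎ flα (y + z) ≡ suc (flα y + flα z)
flα-+ y z with m≤n⇒m<n∨m≡n (flα-greatest (y + z) (Below-+ {flα y} {y} (flα-Below y) (flα-Below z)))
... | inj₂ eq = inj₁ (sym eq)
... | inj₁ lt = inj₂ (≤-antisym (≤-pred (≤-trans
        (Above⇒flα< (Above-+ {suc (flα y)} {y} (flα-Above y) (flα-Above z)))
        (≤-reflexive (cong suc (+-suc (flα y) (flα z)))))) lt)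

-- Kept opaque: the type checker would otherwise unfold the search defining flα.
opaque
  fl : ℕ → ℕ
  fl = flα

  ⌊_α⌋ : ℤ → ℤ
  ⌊_α⌋ = floorα

  ⌊α⌋≡floorα : ∀ z → ⌊ z α⌋ ≡ floorα z
  ⌊α⌋≡floorα z = refl

  fl-+ : ∀ y z → fl (y + z) ≡ fl y + fl z ⊎ fl (y + z) ≡ suc (fl y + fl z)
  fl-+ = flα-+

  fl-greatest : ∀ {m} n → Below m n → m ≤ fl n
  fl-greatest = flα-greatest

  Above⇒fl< : ∀ {m n} → Above m n → fl n < m
  Above⇒fl< = Above⇒flα<

  ⌊+α⌋ : ∀ n → ⌊ + n α⌋ ≡ + fl n
  ⌊+α⌋ n = refl

  fl-0 : fl 0 ≡ 0
  fl-0 = refl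

  ⌊-α⌋ : ∀ n → ⌊ -[1+ n ] α⌋ ≡ -[1+ fl (suc n) ]
  ⌊-α⌋ n = refl

Jump : ℤ → ℤ → ℕ → Set
Jump x y a = y ≡ x ℤ.+ + a ⊎ y ≡ x ℤ.+ + suc a

jump-up : ∀ s r {a} → a ≡ s + r ⊎ a ≡ suc (s + r) → Jump -[1+ s ] (+ r) a
jump-up s r = λ { (inj₁ refl) → inj₂ cancel ; (inj₂ refl) → inj₁ cancel }
  where
  cancel : + r ≡ suc (s + r) ℤ.⊖ suc s
  cancel = sym (trans (ℤₚ.⊖-≥ (s≤s (m≤m+n s r))) (cong +_ (m+n∸m≡n (suc s) r)))

[1+]-cancel : ∀ a s → -[1+ s ] ≡ -[1+ a + s ] ℤ.+ + a
[1+]-cancel a s = sym (trans (cong₂ ℤ._⊖_ (sym (+-identityʳ a)) (sym (+-suc a s))) (ℤₚ.+-cancelˡ-⊖ a 0 (suc s)))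

jump-below : ∀ a s {b} → b ≡ a + s ⊎ b ≡ suc (a + s) → Jump -[1+ b ] -[1+ s ] a
jump-below a s (inj₁ refl) = inj₁ ([1+]-cancel a s)
jump-below a s (inj₂ refl) = inj₂ ([1+]-cancel (suc a) s)

-- Three cases by the signs of z and z + n, each an instance of `fl-+`. Where the sign changes, ⌊-x
-- α⌋ = -⌊x α⌋ - 1 makes its two alternatives trade places.
⌊α⌋-+ : ∀ z n → Jump ⌊ z α⌋ ⌊ z ℤ.+ + n α⌋ (fl n)
⌊α⌋-+ (+ m) n rewrite ⌊+α⌋ m | ⌊+α⌋ (m + n) with fl-+ m n
... | inj₁ eq = inj₁ (cong +_ eq)
... | inj₂ eq = inj₂ (cong +_ (trans eq (sym (+-suc (fl m) (fl n)))))
⌊α⌋-+ -[1+ m ] n with suc m ≤? n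
... | yes m<n with d , refl ← m≤n⇒∃[o]m+o≡n m<n
  rewrite ⌊-α⌋ m | ℤₚ.⊖-≥ m<n | m+n∸m≡n m d | ⌊+α⌋ d = jump-up (fl (suc m)) (fl d) (fl-+ (suc m) d)
⌊α⌋-+ -[1+ m ] n | no m≮n with d , refl ← m≤n⇒∃[o]m+o≡n (≮⇒≥ m≮n)
  rewrite sym ([1+]-cancel n d) | ⌊-α⌋ (n + d) | ⌊-α⌋ d | sym (+-suc n d) = jump-below (fl n) (fl (suc d)) (fl-+ n (suc d))

-- The indicator functions μ l

-- F (l - 1), continued by F (-1) = 0 so that the recurrence holds from `l = 0` on.
Fp : ℕ → ℕ
Fp zero    = 0
Fp (suc l) = F l

F-suc : ∀ l → F (suc l) ≡ F l + Fp l
F-suc zero    = refl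
F-suc (suc l) = refl

F-pos : ∀ l → 1 ≤ F l
F-pos zero          = ≤-refl
F-pos (suc zero)    = ≤-refl
F-pos (suc (suc l)) = ≤-trans (F-pos (suc l)) (m≤m+n _ _)

F-mono : ∀ l → F l ≤ F (suc l)
F-mono l = ≤-trans (m≤m+n (F l) (Fp l)) (≤-reflexive (sym (F-suc l)))

σ : ℕ → ℤ
σ zero    = 1ℤ
σ (suc l) = ℤ.- σ l

-- Cassini's identity as F(l)² - F(l) F(l-1) - F(l-1)² = (-1)^l. It tells on which side of `F l` α
-- the integer `Fp l` lies; the recurrence flips the sign.
cassini : ∀ l → let a = Fp l; f = F l in
  (σ l ≡ 1ℤ × a * a + a * f + 1 ≡ f * f) ⊎ (σ l ≡ -1ℤ × a * a + a * f ≡ f * f + 1)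
cassini zero = inj₁ (refl , refl)
cassini (suc l) with cassini l
... | inj₁ (s , e) = inj₂ (cong ℤ.-_ s , (begin
        f * f + f * F (suc l)          ≡⟨ cong (λ x → f * f + f * x) (F-suc l) ⟩
        f * f + f * (f + a)            ≡⟨ cong (_+ f * (f + a)) e ⟨
        a * a + a * f + 1 + f * (f + a) ≡⟨ ring a f ⟩
        (f + a) * (f + a) + 1          ≡⟨ cong (λ x → x * x + 1) (F-suc l) ⟨
        F (suc l) * F (suc l) + 1      ∎))
  where
  open ≡-Reasoning
  a = Fp l
  f = F l
  ring : ∀ a f → a * a + a * f + 1 + f * (f + a) ≡ (f + a) * (f + a) + 1
  ring = ℕ-Solver.solve-∀
... | inj₂ (s , e) = inj₁ (cong ℤ.-_ s , (begin
        f * f + f * F (suc l) + 1       ≡⟨ cong (λ x → f * f + f * x + 1) (F-suc l) ⟩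
        f * f + f * (f + a) + 1         ≡⟨ ring₁ a f ⟩
        (f * f + 1) + f * (f + a)       ≡⟨ cong (_+ f * (f + a)) e ⟨
        a * a + a * f + f * (f + a)     ≡⟨ ring₂ a f ⟩
        (f + a) * (f + a)               ≡⟨ cong (λ x → x * x) (F-suc l) ⟨
        F (suc l) * F (suc l)           ∎))
  where
  open ≡-Reasoning
  a = Fp l
  f = F l
  ring₁ : ∀ a f → f * f + f * (f + a) + 1 ≡ (f * f + 1) + f * (f + a)
  ring₁ = ℕ-Solver.solve-∀
  ring₂ : ∀ a f → a * a + a * f + f * (f + a) ≡ (f + a) * (f + a)
  ring₂ = ℕ-Solver.solve-∀

fl-unique : ∀ {m} n → Below m n → Above (suc m) n → fl n ≡ m
fl-unique n below above = ≤-antisym (≤-pred (Above⇒fl< above)) (fl-greatest n below)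

-- Four times Cassini's identity reads (2a + f)² = 5f² - 4, so a lies just below f α. In `fl-odd` it
-- reads (2(b + 1) + f)² = 5f² + 4, so b + 1 lies just above f α and the floor is b.
fl-even : ∀ a f → 1 ≤ f → a * a + a * f + 1 ≡ f * f → fl f ≡ a
fl-even a f 1≤f e = fl-unique f
  (≤-certificate 4 (*-monoʳ-≤ 4 (≤-reflexive e)) (ring₁ a f))
  (≤-certificate (8 * a + 3) (+-mono-≤ 1≤f₄ (*-monoʳ-≤ 4 (≤-reflexive (sym e)))) (ring₂ a f))
  where
  1≤f₄ : 4 * 1 ≤ 4 * f
  1≤f₄ = *-monoʳ-≤ 4 1≤f
  ring₁ : ∀ a f → (2 * a + f) * (2 * a + f) + 4 * (f * f) + 4 ≡ 5 * (f * f) + 4 * (a * a + a * f + 1)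
  ring₁ = ℕ-Solver.solve-∀
  ring₂ : ∀ a f → (1 + 5 * (f * f)) + (4 * f + 4 * (a * a + a * f + 1)) + (8 * a + 3)
    ≡ (2 * (1 + a) + f) * (2 * (1 + a) + f) + (4 * 1 + 4 * (f * f))
  ring₂ = ℕ-Solver.solve-∀

fl-odd : ∀ b f → suc b * suc b + suc b * f ≡ f * f + 1 → fl f ≡ b
fl-odd b f e = fl-unique f
  (≤-certificate (8 * b + 4 * f) (*-monoʳ-≤ 4 (≤-reflexive e)) (ring₁ b f))
  (≤-certificate 3 (*-monoʳ-≤ 4 (≤-reflexive (sym e))) (ring₂ b f))
  where
  ring₁ : ∀ b f → (2 * b + f) * (2 * b + f) + 4 * (f * f + 1) + (8 * b + 4 * f)
    ≡ 5 * (f * f) + 4 * ((1 + b) * (1 + b) + (1 + b) * f)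
  ring₁ = ℕ-Solver.solve-∀
  ring₂ : ∀ b f → (1 + 5 * (f * f)) + 4 * ((1 + b) * (1 + b) + (1 + b) * f) + 3
    ≡ (2 * (1 + b) + f) * (2 * (1 + b) + f) + 4 * (f * f + 1)
  ring₂ = ℕ-Solver.solve-∀

fl-F : ∀ l → (σ l ≡ 1ℤ × fl (F l) ≡ Fp l) ⊎ (σ l ≡ -1ℤ × suc (fl (F l)) ≡ Fp l)
fl-F l with cassini l
... | inj₁ (s , e) = inj₁ (s , fl-even (Fp l) (F l) (F-pos l) e)
... | inj₂ (s , e) with Fp l
...   | zero  = contradiction (trans e (+-comm (F l * F l) 1)) λ ()
...   | suc b = inj₂ (s , cong suc (fl-odd b (F l) e))

μ : ℕ → ℤ → ℤ
μ l z = σ l ℤ.* (⌊ z ℤ.+ + F l α⌋ ℤ.- ⌊ z α⌋ ℤ.- + Fp l)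

M : ℕ → ℤ → Set
M l z = μ l z ≡ 1ℤ

Bit : ℤ → Set
Bit x = x ≡ 0ℤ ⊎ x ≡ 1ℤ

μ-bit : ∀ l z → Bit (μ l z)
μ-bit l z with fl-F l | ⌊α⌋-+ z (F l)
... | inj₁ (s , e) | inj₁ j rewrite s | j | e = inj₁ (ring ⌊ z α⌋ (+ Fp l))
  where
  ring : ∀ x p → 1ℤ ℤ.* (x ℤ.+ p ℤ.- x ℤ.- p) ≡ 0ℤ
  ring = ℤ-Solver.solve-∀
... | inj₁ (s , e) | inj₂ j rewrite s | j | e = inj₂ (ring ⌊ z α⌋ (+ Fp l))
  where
  ring : ∀ x p → 1ℤ ℤ.* (x ℤ.+ (1ℤ ℤ.+ p) ℤ.- x ℤ.- p) ≡ 1ℤ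
  ring = ℤ-Solver.solve-∀
... | inj₂ (s , e) | inj₁ j rewrite s | j | sym e = inj₂ (ring ⌊ z α⌋ (+ fl (F l)))
  where
  ring : ∀ x p → -1ℤ ℤ.* (x ℤ.+ p ℤ.- x ℤ.- (1ℤ ℤ.+ p)) ≡ 1ℤ
  ring = ℤ-Solver.solve-∀
... | inj₂ (s , e) | inj₂ j rewrite s | j | sym e = inj₁ (ring ⌊ z α⌋ (+ fl (F l)))
  where
  ring : ∀ x p → -1ℤ ℤ.* (x ℤ.+ (1ℤ ℤ.+ p) ℤ.- x ℤ.- (1ℤ ℤ.+ p)) ≡ 0ℤ
  ring = ℤ-Solver.solve-∀

-- The step F (l + 2) is taken as F l and then F (l + 1); in `μ-join` the order is reversed. As σ
-- alternates, the middle term enters with a plus sign.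
μ-split : ∀ l z → μ l z ≡ μ (2 + l) z ℤ.+ μ (1 + l) (z ℤ.+ + F l)
μ-split l z rewrite ℤₚ.+-assoc z (+ F l) (+ F (suc l)) | +-comm (F l) (F (suc l)) | F-suc l =
  ring (σ l) ⌊ z α⌋ ⌊ z ℤ.+ + F l α⌋ ⌊ z ℤ.+ + (F l + Fp l + F l) α⌋ (+ Fp l) (+ F l)
  where
  ring : ∀ s a b c p q → s ℤ.* (b ℤ.- a ℤ.- p)
    ≡ (ℤ.- (ℤ.- s)) ℤ.* (c ℤ.- a ℤ.- (q ℤ.+ p)) ℤ.+ (ℤ.- s) ℤ.* (c ℤ.- b ℤ.- q)
  ring = ℤ-Solver.solve-∀

μ-join : ∀ l z → μ l (z ℤ.+ + F (suc l)) ≡ μ (2 + l) z ℤ.+ μ (1 + l) z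
μ-join l z rewrite ℤₚ.+-assoc z (+ F (suc l)) (+ F l) | F-suc l =
  ring (σ l) ⌊ z α⌋ ⌊ z ℤ.+ + (F l + Fp l) α⌋ ⌊ z ℤ.+ + (F l + Fp l + F l) α⌋ (+ Fp l) (+ F l)
  where
  ring : ∀ s a b c p q → s ℤ.* (c ℤ.- b ℤ.- p)
    ≡ (ℤ.- (ℤ.- s)) ℤ.* (c ℤ.- a ℤ.- (q ℤ.+ p)) ℤ.+ (ℤ.- s) ℤ.* (b ℤ.- a ℤ.- q)
  ring = ℤ-Solver.solve-∀

-- The increase is 0 or 1 because `fl 1` is 0, and `v₀` tests whether it is positive.
⌊α⌋-suc : ∀ z → ⌊ z ℤ.+ 1ℤ α⌋ ≡ ⌊ z α⌋ ℤ.+ + v₀ z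
⌊α⌋-suc z with fl-F 0 | ⌊α⌋-+ z 1
... | inj₂ (() , _) | _
... | inj₁ (_ , e) | j with floorα z ℤ.<? floorα (z ℤ.+ 1ℤ)
...   | yes z<z+1 = conclude j
  where
  conclude : Jump ⌊ z α⌋ ⌊ z ℤ.+ 1ℤ α⌋ (fl 1) → ⌊ z ℤ.+ 1ℤ α⌋ ≡ ⌊ z α⌋ ℤ.+ 1ℤ
  conclude (inj₁ j) = contradiction
    (trans (sym (⌊α⌋≡floorα z)) (trans (sym (ℤₚ.+-identityʳ _))
      (trans (cong (λ x → ⌊ z α⌋ ℤ.+ + x) (sym e)) (trans (sym j) (⌊α⌋≡floorα (z ℤ.+ 1ℤ))))))
    (ℤₚ.<⇒≢ z<z+1)
  conclude (inj₂ j) = trans j (cong (λ x → ⌊ z α⌋ ℤ.+ + suc x) e)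
...   | no  z≮z+1 = conclude j
  where
  conclude : Jump ⌊ z α⌋ ⌊ z ℤ.+ 1ℤ α⌋ (fl 1) → ⌊ z ℤ.+ 1ℤ α⌋ ≡ ⌊ z α⌋ ℤ.+ 0ℤ
  conclude (inj₁ j) = trans j (cong (λ x → ⌊ z α⌋ ℤ.+ + x) e)
  conclude (inj₂ j) = contradiction
    (subst₂ ℤ._<_ (⌊α⌋≡floorα z) (⌊α⌋≡floorα (z ℤ.+ 1ℤ))
      (subst₂ ℤ._<_ (ℤₚ.+-identityʳ _) (sym j) (ℤₚ.+-monoʳ-< ⌊ z α⌋ (ℤ.+<+ z<s)))) z≮z+1

-- Here `F 0 = F 1 = 1`, so both `μ 0` and `μ 1` look at a single letter: `M 0` and `M 1` are the
-- positions of the letters 1 and 0.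
μ₀≡v₀ : ∀ z → μ 0 z ≡ + v₀ z
μ₀≡v₀ z rewrite ⌊α⌋-suc z = ring ⌊ z α⌋ (+ v₀ z)
  where
  ring : ∀ x v → 1ℤ ℤ.* (x ℤ.+ v ℤ.- x ℤ.- 0ℤ) ≡ v
  ring = ℤ-Solver.solve-∀

μ₁+v₀≡1 : ∀ z → μ 1 z ℤ.+ + v₀ z ≡ 1ℤ
μ₁+v₀≡1 z rewrite ⌊α⌋-suc z = ring ⌊ z α⌋ (+ v₀ z)
  where
  ring : ∀ x v → -1ℤ ℤ.* (x ℤ.+ v ℤ.- x ℤ.- 1ℤ) ℤ.+ v ≡ 1ℤ
  ring = ℤ-Solver.solve-∀

-- Reading μ l off the letters of v₀

ones : ℤ → ℕ → ℕ
ones z zero    = 0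
ones z (suc t) = ones z t + v₀ (z ℤ.+ + t)

⌊α⌋-ones : ∀ z t → ⌊ z ℤ.+ + t α⌋ ≡ ⌊ z α⌋ ℤ.+ + ones z t
⌊α⌋-ones z zero    = trans (cong ⌊_α⌋ (ℤₚ.+-identityʳ z)) (sym (ℤₚ.+-identityʳ ⌊ z α⌋))
⌊α⌋-ones z (suc t) = begin
  ⌊ z ℤ.+ + suc t α⌋                                    ≡⟨ cong (λ x → ⌊ z ℤ.+ + x α⌋) (+-comm t 1) ⟨
  ⌊ z ℤ.+ (+ t ℤ.+ 1ℤ) α⌋                               ≡⟨ cong ⌊_α⌋ (ℤₚ.+-assoc z (+ t) 1ℤ) ⟨
  ⌊ z ℤ.+ + t ℤ.+ 1ℤ α⌋                                 ≡⟨ ⌊α⌋-suc (z ℤ.+ + t) ⟩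
  ⌊ z ℤ.+ + t α⌋ ℤ.+ + v₀ (z ℤ.+ + t)                   ≡⟨ cong (ℤ._+ + v₀ (z ℤ.+ + t)) (⌊α⌋-ones z t) ⟩
  ⌊ z α⌋ ℤ.+ + ones z t ℤ.+ + v₀ (z ℤ.+ + t)            ≡⟨ ℤₚ.+-assoc ⌊ z α⌋ (+ ones z t) (+ v₀ (z ℤ.+ + t)) ⟩
  ⌊ z α⌋ ℤ.+ + (ones z t + v₀ (z ℤ.+ + t))              ∎
  where open ≡-Reasoning

-- The floor counts ones, so `F l` letters from z on decide whether z is in `M l`. Through `μ-cong`
-- an occurrence of a long enough word thus fixes elements of `M l`.
μ-ones : ∀ l z → μ l z ≡ σ l ℤ.* (+ ones z (F l) ℤ.- + Fp l)
μ-ones l z rewrite ⌊α⌋-ones z (F l) = ring (σ l) ⌊ z α⌋ (+ ones z (F l)) (+ Fp l)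
  where
  ring : ∀ s x v p → s ℤ.* (x ℤ.+ v ℤ.- x ℤ.- p) ≡ s ℤ.* (v ℤ.- p)
  ring = ℤ-Solver.solve-∀

record Agree (n : ℕ) (z z′ : ℤ) : Set where
  constructor agree
  field letter : ∀ t → t < n → v₀ (z ℤ.+ + t) ≡ v₀ (z′ ℤ.+ + t)

open Agree

Agree-shift : ∀ {n z z′} c {m} → c + m ≤ n → Agree n z z′ → Agree m (z ℤ.+ + c) (z′ ℤ.+ + c)
Agree-shift {z = z} {z′} c {m} c+m≤n a .letter t t<m =
  trans (cong v₀ (ℤₚ.+-assoc z (+ c) (+ t)))
    (trans (letter a (c + t) (≤-trans (+-monoʳ-< c t<m) c+m≤n)) (cong v₀ (sym (ℤₚ.+-assoc z′ (+ c) (+ t)))))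

ones-cong : ∀ {n z z′} → Agree n z z′ → ones z n ≡ ones z′ n
ones-cong {zero}  a = refl
ones-cong {suc n} a =
  cong₂ _+_ (ones-cong (agree λ t t<n → letter a t (m≤n⇒m≤1+n t<n))) (letter a n ≤-refl)

μ-cong : ∀ {n z z′} l c → c + F l ≤ n → Agree n z z′ → μ l (z ℤ.+ + c) ≡ μ l (z′ ℤ.+ + c)
μ-cong {z = z} {z′} l c c+F≤n a = begin
  μ l (z ℤ.+ + c)                                         ≡⟨ μ-ones l (z ℤ.+ + c) ⟩
  σ l ℤ.* (+ ones (z ℤ.+ + c) (F l) ℤ.- + Fp l)           ≡⟨ cong (λ x → σ l ℤ.* (+ x ℤ.- + Fp l)) (ones-cong (Agree-shift c c+F≤n a)) ⟩
  σ l ℤ.* (+ ones (z′ ℤ.+ + c) (F l) ℤ.- + Fp l)          ≡⟨ μ-ones l (z′ ℤ.+ + c) ⟨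
  μ l (z′ ℤ.+ + c)                                        ∎
  where open ≡-Reasoning

win⇒Agree : ∀ {n} z z′ → win n z ≡ win n z′ → Agree n z z′
win⇒Agree {n} z z′ eq .letter t t<n =
  subst (λ x → v₀ (z ℤ.+ + x) ≡ v₀ (z′ ℤ.+ + x)) (Finₚ.toℕ-fromℕ< t<n)
    (trans (sym (lookup∘tabulate (letters z) i)) (trans (cong (λ u → lookup u i) eq) (lookup∘tabulate (letters z′) i)))
  where
  i = fromℕ< t<n
  letters : ℤ → Fin n → ℕ
  letters z t = v₀ (z ℤ.+ + toℕ t)

Agree⇒win : ∀ {n} z z′ → Agree n z z′ → win n z ≡ win n z′
Agree⇒win z z′ a = tabulate-cong (λ t → letter a (toℕ t) (Finₚ.toℕ<n t))

-- The sets M l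

-- Two bits whose sum is a bit cannot both be 1. This turns the identities for μ into implications
-- between the sets `M l`.
bit-summandˡ : ∀ {x y w} → Bit x → Bit w → x ≡ y ℤ.+ w → y ≡ 1ℤ → x ≡ 1ℤ
bit-summandˡ _           (inj₁ refl) e refl = e
bit-summandˡ (inj₂ refl) _           _ _    = refl
bit-summandˡ (inj₁ refl) (inj₂ refl) () refl

bit-summandʳ : ∀ {x y w} → Bit x → Bit y → x ≡ y ℤ.+ w → w ≡ 1ℤ → x ≡ 1ℤ
bit-summandʳ {y = y} {w} bx by e = bit-summandˡ bx by (trans e (ℤₚ.+-comm y w))

-- This and the next four lemmas read the identities as facts about sets: by `μ-split`, `M l` is
-- made up of `M (2 + l)` and of `M (1 + l)` moved back by `F l`; by `μ-join`, both sets move into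
-- `M l` when shifted forward by `F (1 + l)`.
M-⊂ : ∀ l z → M (2 + l) z → M l z
M-⊂ l z = bit-summandˡ (μ-bit l z) (μ-bit (1 + l) _) (μ-split l z)

M-backward : ∀ l z → M (1 + l) (z ℤ.+ + F l) → M l z
M-backward l z = bit-summandʳ (μ-bit l z) (μ-bit (2 + l) z) (μ-split l z)

M-split : ∀ l z → M l z → M (2 + l) z ⊎ M (1 + l) (z ℤ.+ + F l)
M-split l z m with μ-bit (2 + l) z
... | inj₂ m″ = inj₁ m″
... | inj₁ e  = inj₂ (trans (sym (trans (μ-split l z)
                  (trans (cong (ℤ._+ μ (1 + l) (z ℤ.+ + F l)) e) (ℤₚ.+-identityˡ _)))) m)

M-forward₂ : ∀ l z → M (2 + l) z → M l (z ℤ.+ + F (1 + l))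
M-forward₂ l z = bit-summandˡ (μ-bit l _) (μ-bit (1 + l) z) (μ-join l z)

M-forward₁ : ∀ l z → M (1 + l) z → M l (z ℤ.+ + F (1 + l))
M-forward₁ l z = bit-summandʳ (μ-bit l _) (μ-bit (2 + l) z) (μ-join l z)

M₀⇒v₀≡1 : ∀ {z} → M 0 z → v₀ z ≡ 1
M₀⇒v₀≡1 {z} m = ℤₚ.+-injective (trans (sym (μ₀≡v₀ z)) m)

M₁⇒v₀≡0 : ∀ {z} → M 1 z → v₀ z ≡ 0
M₁⇒v₀≡0 {z} m = suc-injective (ℤₚ.+-injective (trans (cong (ℤ._+ + v₀ z) (sym m)) (μ₁+v₀≡1 z)))

v₀≡0⇒M₁ : ∀ {z} → v₀ z ≡ 0 → M 1 z
v₀≡0⇒M₁ {z} e = trans (sym (ℤₚ.+-identityʳ (μ 1 z))) (trans (cong (λ x → μ 1 z ℤ.+ + x) (sym e)) (μ₁+v₀≡1 z))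

M₀⇒¬M₁ : ∀ {z} → M 0 z → ¬ M 1 z
M₀⇒¬M₁ {z} m₀ m₁ = contradiction (trans (sym (M₀⇒v₀≡1 {z} m₀)) (M₁⇒v₀≡0 {z} m₁)) λ ()

M-at : ∀ l {x y} → x ≡ y → M l x → M l y
M-at l = subst (M l)

+-shift : ∀ z a b {c} → a + b ≡ c → z ℤ.+ + a ℤ.+ + b ≡ z ℤ.+ + c
+-shift z a b refl = ℤₚ.+-assoc z (+ a) (+ b)

-+-cancel : ∀ z x → z ℤ.- x ℤ.+ x ≡ z
-+-cancel = ℤ-Solver.solve-∀

F-suc≰F : ∀ l → ¬ F (2 + l) ≤ F (1 + l)
F-suc≰F l h = <⇒≱ (m<m+n (F (1 + l)) (F-pos l)) h

-- Distances between elements of M l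

Gap : ℕ → Set
Gap l = ∀ z p → 0 < p → M l z → M l (z ℤ.+ + p) → F (1 + l) ≤ p

-- The distances to both ends are at least `F (1 + l)` and add up to `F (1 + l) + F l`. The two
-- resulting bounds on `p` conflict for l ≥ 1; for l = 0 they force p = 1.
gap-interior : ∀ l → Gap l → ∀ z p → 0 < p → p < F (2 + l) →
  M l z → M l (z ℤ.+ + p) → M l (z ℤ.+ + F (2 + l)) → F (1 + l) ≤ p × p ≤ F l
gap-interior l gap z p 0<p p<F m m′ m″ = gap z p 0<p m m′ , p≤F
  where
  q = F (2 + l) ∸ p
  p+q≡F : p + q ≡ F (2 + l)
  p+q≡F = m+[n∸m]≡n (<⇒≤ p<F)
  F≤q : F (1 + l) ≤ q
  F≤q = gap (z ℤ.+ + p) q (m<n⇒0<n∸m p<F) m′ (M-at l (sym (+-shift z p q p+q≡F)) m″)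
  p≤F : p ≤ F l
  p≤F = +-cancelˡ-≤ (F (1 + l)) p (F l)
    (≤-trans (+-monoˡ-≤ p F≤q) (≤-reflexive (trans (+-comm q p) p+q≡F)))

-- Shifted back by `F L`, both elements of `M (1 + L)` land in `M L`; shifted forward by
-- `F (1 + L)`, so does the first. If p were too small, `M L` would have an element strictly inside
-- an interval of length `F (2 + L)` with both ends in `M L`.
gap-step : ∀ l → Gap (1 + l) → Gap (2 + l)
gap-step l gapL z p 0<p m m′ = ≮⇒≥ λ p<F →
  let lower , upper = gap-interior L gapL z₀ p 0<p p<F at-0 at-p at-F in
  F-suc≰F l (≤-trans lower upper)
  where
  L = suc l
  z₀ = z ℤ.- + F L
  at-0 : M L z₀
  at-0 = M-backward L z₀ (M-at (1 + L) (sym (-+-cancel z (+ F L))) m)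
  at-p : M L (z₀ ℤ.+ + p)
  at-p = M-backward L (z₀ ℤ.+ + p) (M-at (1 + L) (sym (ring z (+ F L) (+ p))) m′)
    where
    ring : ∀ z f p → z ℤ.- f ℤ.+ p ℤ.+ f ≡ z ℤ.+ p
    ring = ℤ-Solver.solve-∀
  at-F : M L (z₀ ℤ.+ + F (2 + L))
  at-F = M-at L (sym (ring z (+ F L) (+ F (1 + L)))) (M-forward₁ L z m)
    where
    ring : ∀ z f g → z ℤ.- f ℤ.+ (g ℤ.+ f) ≡ z ℤ.+ g
    ring = ℤ-Solver.solve-∀

gap : ∀ l → Gap l
gap zero z p 0<p _ _ = 0<p
-- A letter 0 is always followed by a 1.
gap (suc zero) z (suc zero) _ m m′ = contradiction m′ (M₀⇒¬M₁ {z ℤ.+ 1ℤ} (M-forward₁ 0 z m))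
gap (suc zero) z (suc (suc p)) _ _ _ = s≤s (s≤s z≤n)
gap (suc (suc l)) = gap-step l (gap (suc l))

-- The class of z in `M-split` decides: an element of `M (2 + l)` moves forward by `F (1 + l)`, and
-- for the others the step `F l` into `M (1 + l)` is followed by a step `F (1 + l)`.
M-next : ∀ l z → M l z → M l (z ℤ.+ + F (1 + l)) ⊎ M l (z ℤ.+ + F (2 + l))
M-next l z m with M-split l z m
... | inj₁ m₂ = inj₁ (M-forward₂ l z m₂)
... | inj₂ m₁ = inj₂ (M-at l (+-shift z (F l) (F (1 + l)) (+-comm (F l) (F (1 + l)))) (M-forward₁ l _ m₁))

return-time : ∀ l z p → 0 < p → M l z → M l (z ℤ.+ + p) →
  (∀ q → 0 < q → q < p → ¬ M l (z ℤ.+ + q)) → p ≡ F (1 + l) ⊎ p ≡ F (2 + l)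
return-time l z p 0<p m m′ first with M-next l z m
... | inj₁ next = inj₁ (≤-antisym (≮⇒≥ λ F<p → first _ (F-pos (1 + l)) F<p next) (gap l z p 0<p m m′))
... | inj₂ next with <-cmp p (F (2 + l))
...   | tri≈ _ p≡F _ = inj₂ p≡F
...   | tri> _ _ F<p = contradiction next (first _ (F-pos (2 + l)) F<p)
-- The bounds give F (1 + l) ≤ p ≤ F l ≤ F (1 + l), which is possible only for l = 0.
...   | tri< p<F _ _ = let lower , upper = gap-interior l (gap l) z p 0<p p<F m m′ next in
                       inj₁ (≤-antisym (≤-trans upper (F-mono l)) lower)

-- The elements of M l near the origin

σ-sign : ∀ l → σ l ≡ 1ℤ ⊎ σ l ≡ -1ℤ
σ-sign zero = inj₁ refl
σ-sign (suc l) with σ-sign l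
... | inj₁ e = inj₂ (cong ℤ.-_ e)
... | inj₂ e = inj₁ (cong ℤ.-_ e)

-- For odd l the interval that defines `M l` starts at 0, the value of x at the origin.
M-origin : ∀ l → σ l ≡ -1ℤ → M l 0ℤ
M-origin l odd with fl-F l
... | inj₁ (even , _) = contradiction (trans (sym even) odd) λ ()
... | inj₂ (_ , e) rewrite odd | ⌊+α⌋ (F l) | ⌊+α⌋ 0 | fl-0 | sym e = ring (+ fl (F l))
  where
  ring : ∀ x → -1ℤ ℤ.* (x ℤ.- 0ℤ ℤ.- (1ℤ ℤ.+ x)) ≡ 1ℤ
  ring = ℤ-Solver.solve-∀

-- One of 1 + l and 2 + l is odd, so the origin lies in `M (1 + l)` or `M (2 + l)`; either way it
-- moves forward by `F (1 + l)` into `M l`.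
M-anchor : ∀ l → M l (+ F (1 + l))
M-anchor l with σ-sign l
... | inj₁ even = M-forward₁ l 0ℤ (M-origin (1 + l) (cong ℤ.-_ even))
... | inj₂ odd  = M-forward₂ l 0ℤ (M-origin (2 + l) (cong (λ s → ℤ.- (ℤ.- s)) odd))

M-beyond-anchor : ∀ l s → M l (+ s) → F (1 + l) < s → s < F (3 + l) → F (1 + l) ≤ F l
M-beyond-anchor l s m F<s s<F with p , refl ← m≤n⇒∃[o]m+o≡n (<⇒≤ F<s) =
  let lower , upper = gap-interior l (gap l) (+ F (1 + l)) p
        (+-cancelˡ-< (F (1 + l)) 0 p (≤-trans (≤-reflexive (cong suc (+-identityʳ _))) F<s))
        (+-cancelˡ-< (F (1 + l)) p (F (2 + l)) (≤-trans s<F (≤-reflexive F≡)))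
        (M-anchor l) m (M-at l (cong +_ F≡) (M-⊂ l _ (M-anchor (2 + l))))
  in ≤-trans lower upper
  where
  F≡ : F (3 + l) ≡ F (1 + l) + F (2 + l)
  F≡ = +-comm (F (2 + l)) (F (1 + l))

-- For l = 0 and l = 1 the first letters of `v₀` are inspected. Afterwards `s` is compared with the
-- anchor: above it `M-beyond-anchor` excludes `s`, below it the induction hypothesis does.
M-locate : ∀ l s → 1 ≤ s → s < F (3 + l) → M l (+ s) → s ≡ F (1 + l)
M-locate zero zero () _ _
M-locate zero 1 _ _ m = refl
M-locate zero 2 _ _ m with () ← M₀⇒v₀≡1 {+ 2} m
M-locate zero (suc (suc (suc _))) _ (s≤s (s≤s (s≤s ()))) _
M-locate 1 1 _ _ m with () ← M₁⇒v₀≡0 {+ 1} m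
M-locate 1 2 _ _ m = refl
M-locate 1 3 _ _ m with () ← M₁⇒v₀≡0 {+ 3} m
M-locate 1 4 _ _ m with () ← M₁⇒v₀≡0 {+ 4} m
M-locate 1 (suc (suc (suc (suc (suc _))))) _ (s≤s (s≤s (s≤s (s≤s (s≤s ()))))) _
M-locate (suc (suc l)) s 1≤s s<F m with <-cmp s (F (3 + l))
... | tri≈ _ s≡F _ = s≡F
... | tri> _ _ F<s = contradiction (M-beyond-anchor (2 + l) s m F<s s<F) (F-suc≰F (1 + l))
-- As an element of `M l`, `s` must be `F (1 + l)`. Its distance `F (2 + l)` to the anchor
-- `F (3 + l)` is too short for `M (2 + l)`.
... | tri< s<F′ _ _ with refl ← M-locate l s 1≤s s<F′ (M-⊂ l (+ s) m) =
  contradiction (gap (2 + l) (+ F (1 + l)) (F (2 + l)) (F-pos (2 + l)) m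
    (M-at (2 + l) (cong +_ (+-comm (F (2 + l)) (F (1 + l)))) (M-anchor (2 + l)))) (F-suc≰F (1 + l))

-- The central word around an element of M l

Central : ℕ → Set
Central l = ∀ z → M l (z ℤ.+ + F (1 + l)) → ∀ s → 1 ≤ s → s + 2 ≤ F (3 + l) → v₀ (z ℤ.+ + s) ≡ v₀ (+ s)

-- The longer word is covered by two overlapping copies of the shorter one, at offsets 0 and
-- `F (3 + l)`: an element of `M (2 + l)` yields elements of `M (1 + l)` by a backward and a forward
-- shift. The same holds at the anchor, so the second copies agree as well.
central-step : ∀ l → Central (1 + l) → Central (2 + l)
central-step l central z m s 1≤s s+2≤F with s + 2 ≤? F (4 + l)
... | yes short = central z
        (M-backward (1 + l) (z ℤ.+ + F (2 + l)) (M-at (2 + l) (sym (+-shift z (F (2 + l)) (F (1 + l)) refl)) m)) s 1≤s short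
... | no  long = subst (λ s → v₀ (z ℤ.+ + s) ≡ v₀ (+ s)) (m+[n∸m]≡n (<⇒≤ F<s)) (begin
        v₀ (z ℤ.+ + (F (3 + l) + s′))      ≡⟨ cong v₀ (ℤₚ.+-assoc z (+ F (3 + l)) (+ s′)) ⟨
        v₀ (z ℤ.+ + F (3 + l) ℤ.+ + s′)    ≡⟨ central (z ℤ.+ + F (3 + l)) (M-forward₁ (1 + l) _ m) s′ 1≤s′ s′+2≤F ⟩
        v₀ (+ s′)                          ≡⟨ central (+ F (3 + l)) (M-forward₁ (1 + l) _ (M-anchor (2 + l))) s′ 1≤s′ s′+2≤F ⟨
        v₀ (+ (F (3 + l) + s′))            ∎)
  where
  open ≡-Reasoning
  F<s : F (3 + l) < s
  F<s = +-cancelʳ-< 2 (F (3 + l)) s (≤-<-trans (+-monoʳ-≤ (F (3 + l)) (+-mono-≤ (F-pos (1 + l)) (F-pos l))) (≰⇒> long))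
  s′ = s ∸ F (3 + l)
  1≤s′ : 1 ≤ s′
  1≤s′ = m<n⇒0<n∸m F<s
  s′+2≤F : s′ + 2 ≤ F (4 + l)
  s′+2≤F = +-cancelˡ-≤ (F (3 + l)) (s′ + 2) (F (4 + l)) (≤-trans
    (≤-reflexive (trans (sym (+-assoc (F (3 + l)) s′ 2)) (cong (_+ 2) (m+[n∸m]≡n (<⇒≤ F<s)))))
    (≤-trans s+2≤F (≤-reflexive (+-comm (F (4 + l)) (F (3 + l))))))

M-central : ∀ l → Central l
M-central zero z m 1 _ _ = M₀⇒v₀≡1 {z ℤ.+ 1ℤ} m
M-central zero z m (suc (suc s)) _ (s≤s (s≤s h)) = contradiction (≤-trans (m≤n+m 2 s) h) λ { (s≤s ()) }
M-central 1 z m 1 _ _ = M₀⇒v₀≡1 {z ℤ.+ 1ℤ} (M-backward 0 (z ℤ.+ 1ℤ) (M-at 1 (sym (ℤₚ.+-assoc z 1ℤ 1ℤ)) m))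
M-central 1 z m 2 _ _ = M₁⇒v₀≡0 {z ℤ.+ + 2} m
M-central 1 z m 3 _ _ = M₀⇒v₀≡1 {z ℤ.+ + 3} (M-at 0 (ℤₚ.+-assoc z (+ 2) 1ℤ) (M-forward₁ 0 (z ℤ.+ + 2) m))
M-central 1 z m (suc (suc (suc (suc s)))) _ (s≤s (s≤s (s≤s (s≤s h)))) = contradiction (≤-trans (m≤n+m 2 s) h) λ { (s≤s ()) }
M-central (suc (suc l)) = central-step l (M-central (suc l))

-- Two towers cover ℤ, of height `F (1 + l)` over `M l` and `F l` over `M (1 + l)`. `M-split` cuts
-- the first: one piece becomes the tower over `M (2 + l)`, the other is stacked on the tower over
-- `M (1 + l)`.
M-cover : ∀ l z → (∃ λ a → a < F (1 + l) × M l (z ℤ.+ + a)) ⊎ (∃ λ b → b < F l × M (1 + l) (z ℤ.+ + b))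
M-cover zero z with μ-bit 0 z
... | inj₂ m = inj₁ (0 , ≤-refl , M-at 0 (sym (ℤₚ.+-identityʳ z)) m)
... | inj₁ e = inj₂ (0 , ≤-refl , M-at 1 (sym (ℤₚ.+-identityʳ z)) (v₀≡0⇒M₁ {z} (ℤₚ.+-injective (trans (sym (μ₀≡v₀ z)) e))))
M-cover (suc l) z with M-cover l z
... | inj₂ (b , b<F , m) = inj₁ (b , ≤-trans b<F (m≤n+m (F l) (F (1 + l))) , m)
... | inj₁ (a , a<F , m) with M-split l (z ℤ.+ + a) m
...   | inj₁ m₂ = inj₂ (a , a<F , m₂)
...   | inj₂ m₁ = inj₁ (a + F l , +-monoˡ-< (F l) a<F , M-at (1 + l) (+-shift z a (F l) refl) m₁)

-- Under these conditions w n i occurs at z exactly if z + c is in M l.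
record Marker (n l i c : ℕ) : Set where
  constructor marker
  field
    1≤i   : 1 ≤ i
    i+c≡F : i + c ≡ F (1 + l)
    c+F≤n : c + F l ≤ n
    n<F+c : n < F (2 + l) + c

module _ {n l i c} (mk : Marker n l i c) where
  open Marker mk

  -- By `c+F≤n` the window contains the `F l` letters that decide `μ l` at offset `c`, and at `i`
  -- this offset hits the anchor.
  occurs⇒M : ∀ z → win n z ≡ w n i → M l (z ℤ.+ + c)
  occurs⇒M z eq = trans (μ-cong l c c+F≤n (win⇒Agree z (+ i) eq))
    (M-at l (cong +_ (sym i+c≡F)) (M-anchor l))

  -- By `1≤i` and `n<F+c` the window stays inside the central word.
  M⇒occurs : ∀ z → M l (z ℤ.+ + c) → win n z ≡ w n i
  M⇒occurs z m = Agree⇒win z (+ i) (agree λ t t<n → begin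
    v₀ (z ℤ.+ + t)                     ≡⟨ cong v₀ (ring₁ z (+ i) (+ t)) ⟨
    v₀ (z ℤ.- + i ℤ.+ + (i + t))       ≡⟨ M-central l (z ℤ.- + i) central (i + t) (≤-trans 1≤i (m≤m+n i t)) (fits t t<n) ⟩
    v₀ (+ (i + t))                     ∎)
    where
    open ≡-Reasoning
    ring₁ : ∀ z i t → z ℤ.- i ℤ.+ (i ℤ.+ t) ≡ z ℤ.+ t
    ring₁ = ℤ-Solver.solve-∀
    central : M l (z ℤ.- + i ℤ.+ + F (1 + l))
    central = M-at l (trans (sym (ring₁ z (+ i) (+ c))) (cong (λ x → z ℤ.- + i ℤ.+ + x) i+c≡F)) m
    fits : ∀ t → t < n → i + t + 2 ≤ F (3 + l)
    fits t t<n = ≤-trans (≤-certificate 0 (+-mono-≤ t<n n<F+c) (ring₂ i t n c (F (2 + l))))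
      (≤-reflexive (cong (λ x → F (2 + l) + x) i+c≡F))
      where
      ring₂ : ∀ i t n c f → i + t + 2 + (n + (f + c)) + 0 ≡ f + (i + c) + ((1 + t) + (1 + n))
      ring₂ = ℕ-Solver.solve-∀

-- Windows and their positions

<⇒∃-gap : ∀ {x y} → x ℤ.< y → ∃ λ p → 0 < p × y ≡ x ℤ.+ + p
<⇒∃-gap {x} {y} x<y = ℤ.∣ d ∣ , 0<p , y≡x+p
  where
  d = y ℤ.- x
  ring : ∀ x y → x ℤ.+ (y ℤ.- x) ≡ y
  ring = ℤ-Solver.solve-∀
  y≡x+p : y ≡ x ℤ.+ + ℤ.∣ d ∣
  y≡x+p = trans (sym (ring x y)) (cong (λ d → x ℤ.+ d) (sym (ℤₚ.0≤i⇒+∣i∣≡i (ℤₚ.i≤j⇒0≤j-i (ℤₚ.<⇒≤ x<y)))))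
  0<p : 0 < ℤ.∣ d ∣
  0<p = n≢0⇒n>0 λ p≡0 → ℤₚ.<⇒≢ x<y
    (trans (sym (ℤₚ.+-identityʳ x)) (trans (cong (λ p → x ℤ.+ + p) (sym p≡0)) (sym y≡x+p)))

module _ {n l i c} (mk : Marker n l i c) where
  open Marker mk

  c<F : c < F (1 + l)
  c<F = ≤-trans (+-monoˡ-≤ c 1≤i) (≤-reflexive i+c≡F)

  unique-position : ∀ i′ → 1 ≤ i′ → i′ ≤ F (2 + l) → w n i′ ≡ w n i → i′ ≡ i
  unique-position i′ 1≤i′ i′≤F eq = +-cancelʳ-≡ c i′ i (trans
    (M-locate l (i′ + c) (≤-trans 1≤i′ (m≤m+n i′ c)) (+-mono-≤-< i′≤F c<F) (occurs⇒M mk (+ i′) eq))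
    (sym i+c≡F))

  -- Below `F (3 + l)` only the anchor is in `M l`. `F (3 + l)` itself is in `M l`, and `i′ + c`
  -- exceeds it by less than the minimal gap, since `c < F (1 + l)`.
  two-positions : ∀ i′ → 1 ≤ i′ → i′ ≤ F (3 + l) → w n i′ ≡ w n i → i′ ≡ i ⊎ i′ ≡ F (2 + l) + i
  two-positions i′ 1≤i′ i′≤F eq with <-cmp (i′ + c) (F (3 + l))
  ... | tri< lt _ _ = inj₁ (+-cancelʳ-≡ c i′ i (trans
        (M-locate l (i′ + c) (≤-trans 1≤i′ (m≤m+n i′ c)) lt (occurs⇒M mk (+ i′) eq)) (sym i+c≡F)))
  ... | tri≈ _ e _ = inj₂ (+-cancelʳ-≡ c i′ (F (2 + l) + i) (trans e
        (trans (cong (λ x → F (2 + l) + x) (sym i+c≡F)) (sym (+-assoc (F (2 + l)) i c)))))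
  ... | tri> _ _ gt with p , F+p≡ ← m≤n⇒∃[o]m+o≡n (<⇒≤ gt) = contradiction
        (gap l (+ F (3 + l)) p (+-cancelˡ-< (F (3 + l)) 0 p
            (≤-trans (≤-reflexive (cong suc (+-identityʳ _))) (≤-trans gt (≤-reflexive (sym F+p≡)))))
          (M-⊂ l _ (M-anchor (2 + l)))
          (M-at l (cong +_ (sym F+p≡)) (occurs⇒M mk (+ i′) eq)))
        (<⇒≱ (≤-<-trans (+-cancelˡ-≤ (F (3 + l)) p c (≤-trans (≤-reflexive F+p≡) (+-monoˡ-≤ c i′≤F))) c<F))

  second-position : w n (F (2 + l) + i) ≡ w n i
  second-position = M⇒occurs mk (+ (F (2 + l) + i)) (M-at l
    (cong +_ (sym (trans (+-assoc (F (2 + l)) i c) (cong (λ x → F (2 + l) + x) i+c≡F))))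
    (M-⊂ l _ (M-anchor (2 + l))))

  consecutive-distance : ∀ z z′ → Consecutive (w n i) z z′ →
    z′ ≡ z ℤ.+ + F (1 + l) ⊎ z′ ≡ z ℤ.+ + F (2 + l)
  consecutive-distance z z′ (z<z′ , at-z , at-z′ , none) with p , 0<p , refl ← <⇒∃-gap z<z′ =
    [ inj₁ ∘ cong (λ x → z ℤ.+ + x) , inj₂ ∘ cong (λ x → z ℤ.+ + x) ]′
      (return-time l (z ℤ.+ + c) p 0<p (occurs⇒M mk z at-z)
        (M-at l (swap p) (occurs⇒M mk (z ℤ.+ + p) at-z′))
        λ q 0<q q<p m → none (z ℤ.+ + q)
          (subst (ℤ._< z ℤ.+ + q) (ℤₚ.+-identityʳ z) (ℤₚ.+-monoʳ-< z (ℤ.+<+ 0<q)))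
          (ℤₚ.+-monoʳ-< z (ℤ.+<+ q<p))
          (M⇒occurs mk (z ℤ.+ + q) (M-at l (sym (swap q)) m)))
    where
    ring : ∀ z a b → z ℤ.+ a ℤ.+ b ≡ z ℤ.+ b ℤ.+ a
    ring = ℤ-Solver.solve-∀
    swap : ∀ q → z ℤ.+ + q ℤ.+ + c ≡ z ℤ.+ + c ℤ.+ + q
    swap q = ring z (+ q) (+ c)

-- Counting occurrences and words

module _ {n} (u : Vec ℕ n) where
  private
    u? = λ i → ≡-dec ℕ._≟_ (w n i) u

  count-suc : ∀ N → count n (suc N) u ≡ count n N u + length (filter u? (suc N ∷ []))
  count-suc N = begin
    length (filter u? (map suc (upTo (suc N))))                       ≡⟨ cong (length ∘ filter u? ∘ map suc) (upTo-∷ʳ N) ⟨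
    length (filter u? (map suc (upTo N ++ N ∷ [])))                   ≡⟨ cong (length ∘ filter u?) (map-++ suc (upTo N) (N ∷ [])) ⟩
    length (filter u? (map suc (upTo N) ++ suc N ∷ []))               ≡⟨ cong length (filter-++ u? (map suc (upTo N)) (suc N ∷ [])) ⟩
    length (filter u? (map suc (upTo N)) ++ filter u? (suc N ∷ []))   ≡⟨ length-++ (filter u? (map suc (upTo N))) ⟩
    count n N u + length (filter u? (suc N ∷ []))                     ∎
    where open ≡-Reasoning

  count-hit : ∀ N → w n (suc N) ≡ u → count n (suc N) u ≡ suc (count n N u)
  count-hit N hit = trans (count-suc N)
    (trans (cong (λ L → count n N u + length L) (filter-accept u? hit)) (+-comm (count n N u) 1))

  count-miss : ∀ N → w n (suc N) ≢ u → count n (suc N) u ≡ count n N u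
  count-miss N miss = trans (count-suc N)
    (trans (cong (λ L → count n N u + length L) (filter-reject u? miss)) (+-identityʳ (count n N u)))

  count-flat : ∀ a N → a ≤ N → (∀ i → a < i → i ≤ N → w n i ≢ u) → count n N u ≡ count n a u
  count-flat a zero    z≤n _ = refl
  count-flat a (suc N) a≤N miss with m≤n⇒m<n∨m≡n a≤N
  ... | inj₂ refl = refl
  ... | inj₁ (s≤s a≤N′) = trans (count-miss N (miss (suc N) (s≤s a≤N′) ≤-refl))
                    (count-flat a N a≤N′ λ i a<i i≤N → miss i a<i (m≤n⇒m≤1+n i≤N))

  count-step : ∀ a p N → a < p → p ≤ N → w n p ≡ u →
    (∀ i → a < i → i ≤ N → w n i ≡ u → i ≡ p) → count n N u ≡ suc (count n a u)
  count-step a (suc p) N (s≤s a≤p) p<N hit only = begin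
    count n N u           ≡⟨ count-flat (suc p) N p<N (λ i p<i i≤N e →
                               <⇒≢ p<i (sym (only i (≤-trans (s≤s (m≤n⇒m≤1+n a≤p)) p<i) i≤N e))) ⟩
    count n (suc p) u     ≡⟨ count-hit p hit ⟩
    suc (count n p u)     ≡⟨ cong suc (count-flat a p a≤p λ i a<i i≤p e →
                               <⇒≢ (s≤s i≤p) (only i a<i (≤-trans (m≤n⇒m≤1+n i≤p) p<N) e)) ⟩
    suc (count n a u)     ∎
    where open ≡-Reasoning

range-HasCard : ∀ {n} {P : Vec ℕ n → Set} s c →
  (∀ u → P u → ∃ λ m → m < c × w n (s + m) ≡ u) → (∀ m → m < c → P (w n (s + m))) →
  (∀ m m′ → m < c → m′ < c → w n (s + m) ≡ w n (s + m′) → m ≡ m′) → HasCard P c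
range-HasCard {n} {P} s c P⇒ ⇒P inj = tabulate word , tabulate⁺ word-injective , length-tabulate word , λ u → mk⇔ (to u) (from u)
  where
  word : Fin c → Vec ℕ n
  word t = w n (s + toℕ t)
  word-injective : ∀ {t t′} → word t ≡ word t′ → t ≡ t′
  word-injective {t} {t′} e = Finₚ.toℕ-injective (inj (toℕ t) (toℕ t′) (Finₚ.toℕ<n t) (Finₚ.toℕ<n t′) e)
  to : ∀ u → u ∈ tabulate word → P u
  to u u∈ with t , refl ← ∈-tabulate⁻ u∈ = ⇒P (toℕ t) (Finₚ.toℕ<n t)
  from : ∀ u → P u → u ∈ tabulate word
  from u Pu with m , m<c , refl ← P⇒ u Pu =
    subst (λ x → w n (s + x) ∈ tabulate word) (Finₚ.toℕ-fromℕ< m<c) (∈-tabulate⁺ {f = word} (fromℕ< m<c))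

-- Index ranges of the form G ∸ j + m

∸+-lower : ∀ {j G} m → j ≤ G → G ≤ G ∸ j + m + j
∸+-lower {j} {G} m j≤G = begin
  G               ≡⟨ m∸n+n≡m j≤G ⟨
  G ∸ j + j       ≤⟨ +-monoˡ-≤ j (m≤m+n (G ∸ j) m) ⟩
  G ∸ j + m + j   ∎
  where open ≤-Reasoning

∸+-upper : ∀ {j G m D} → j ≤ G → m ≤ D + j → G ∸ j + m ≤ G + D
∸+-upper {j} {G} {m} {D} j≤G m≤D+j = begin
  G ∸ j + m           ≤⟨ +-monoʳ-≤ (G ∸ j) m≤D+j ⟩
  G ∸ j + (D + j)     ≡⟨ cong (λ x → G ∸ j + x) (+-comm D j) ⟩
  G ∸ j + (j + D)     ≡⟨ +-assoc (G ∸ j) j D ⟨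
  G ∸ j + j + D       ≡⟨ cong (_+ D) (m∸n+n≡m j≤G) ⟩
  G + D               ∎
  where open ≤-Reasoning

∸+-surjective : ∀ {j G D i} → j ≤ G → G ≤ i + j → i ≤ G + D → ∃ λ m → m ≤ D + j × G ∸ j + m ≡ i
∸+-surjective {j} {G} {D} {i} j≤G G≤i+j i≤G+D = i ∸ (G ∸ j) , upper , m+[n∸m]≡n (m≤n+o⇒m∸n≤o G j (≤-trans G≤i+j (≤-reflexive (+-comm i j))))
  where
  upper : i ∸ (G ∸ j) ≤ D + j
  upper = m≤n+o⇒m∸n≤o i (G ∸ j) (≤-trans i≤G+D (≤-reflexive (begin
    G + D               ≡⟨ cong (_+ D) (m∸n+n≡m j≤G) ⟨
    G ∸ j + j + D       ≡⟨ +-assoc (G ∸ j) j D ⟩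
    G ∸ j + (j + D)     ≡⟨ cong (λ x → G ∸ j + x) (+-comm j D) ⟩
    G ∸ j + (D + j)     ∎)))
    where open ≡-Reasoning

-- The blocks A, B and C for k = l + 2

module Blocks (l j : ℕ) (j<F : j < F (1 + l)) where

  n : ℕ
  n = F (2 + l) + j

  -- The positions that index the three blocks; `j` is added on the left so that no truncated
  -- subtraction occurs.
  PosA PosB PosC : ℕ → Set
  PosA i = 1 ≤ i × i + j + 1 ≤ F (1 + l)
  PosB i = F (1 + l) ≤ i + j × i ≤ F (2 + l)
  PosC i = F (3 + l) ≤ i + j × i ≤ F (3 + l)

  j≤F₁ : j ≤ F (1 + l)
  j≤F₁ = <⇒≤ j<F

  j<F₃ : j < F (3 + l)
  j<F₃ = ≤-trans j<F (≤-trans (F-mono (1 + l)) (F-mono (2 + l)))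

  positive : ∀ {i G} → j < G → G ≤ i + j → 1 ≤ i
  positive {zero}  j<G G≤j = contradiction G≤j (<⇒≱ j<G)
  positive {suc i} _   _   = s≤s z≤n

  PosA⇒InA : ∀ {i} → PosA i → InA n (2 + l) j (w n i)
  PosA⇒InA {suc m} (_ , h) = m , ≤-trans (≤-reflexive (ring m j)) h , refl
    where
    ring : ∀ m j → m + j + 2 ≡ 1 + m + j + 1
    ring = ℕ-Solver.solve-∀

  posA : ∀ m → m + j + 2 ≤ F (1 + l) → PosA (1 + m)
  posA m h = s≤s z≤n , ≤-trans (≤-reflexive (ring m j)) h
    where
    ring : ∀ m j → 1 + m + j + 1 ≡ m + j + 2
    ring = ℕ-Solver.solve-∀

  InA⇒PosA : ∀ {u} → InA n (2 + l) j u → ∃ λ i → PosA i × w n i ≡ u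
  InA⇒PosA (m , h , e) = 1 + m , posA m h , e

  PosB⇒InB : ∀ {i} → PosB i → InB n (2 + l) j (w n i)
  PosB⇒InB (lower , upper) with m , m≤ , e ← ∸+-surjective j≤F₁ lower upper = m , m≤ , cong (w n) e

  InB⇒PosB : ∀ {u} → InB n (2 + l) j u → ∃ λ i → PosB i × w n i ≡ u
  InB⇒PosB (m , m≤ , e) = F (1 + l) ∸ j + m , (∸+-lower m j≤F₁ , ∸+-upper j≤F₁ m≤) , e

  PosC⇒InC : ∀ {i} → PosC i → InC n (2 + l) j (w n i)
  PosC⇒InC (lower , upper)
    with m , m≤ , e ← ∸+-surjective {D = 0} (<⇒≤ j<F₃) lower (≤-trans upper (m≤m+n _ 0)) = m , m≤ , cong (w n) e

  InC⇒PosC : ∀ {u} → InC n (2 + l) j u → ∃ λ i → PosC i × w n i ≡ u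
  InC⇒PosC (m , m≤ , e) = F (3 + l) ∸ j + m ,
    (∸+-lower m (<⇒≤ j<F₃) , ≤-trans (∸+-upper {D = 0} (<⇒≤ j<F₃) m≤) (≤-reflexive (+-identityʳ _))) , e

  PosA⇒≤F₁ : ∀ {i} → PosA i → i ≤ F (1 + l)
  PosA⇒≤F₁ {i} (_ , h) = ≤-trans (≤-trans (m≤m+n i j) (m≤m+n (i + j) 1)) h

  PosA⇒≤F₂ : ∀ {i} → PosA i → i ≤ F (2 + l)
  PosA⇒≤F₂ pos = ≤-trans (PosA⇒≤F₁ pos) (F-mono (1 + l))

  PosA⇒≤F₃ : ∀ {i} → PosA i → i ≤ F (3 + l)
  PosA⇒≤F₃ pos = ≤-trans (PosA⇒≤F₂ pos) (F-mono (2 + l))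

  PosB⇒≤F₃ : ∀ {i} → PosB i → i ≤ F (3 + l)
  PosB⇒≤F₃ (_ , i≤F) = ≤-trans i≤F (F-mono (2 + l))

  -- The offset `c` leads from `i` to the anchor of the level. For A the bound of `PosA` becomes
  -- `n<F+c`; for B and C, one and two levels up, the lower bound on `i + j` becomes `c+F≤n`.
  markerA : ∀ {i} → PosA i → Marker n l i (F (1 + l) ∸ i)
  markerA {i} pos@(1≤i , h) = marker 1≤i i+c≡F
    (≤-trans (+-monoˡ-≤ (F l) (m∸n≤m (F (1 + l)) i)) (m≤m+n (F (2 + l)) j))
    (+-monoʳ-< (F (2 + l)) j<c)
    where
    i+c≡F = m+[n∸m]≡n (PosA⇒≤F₁ pos)
    j<c : j < F (1 + l) ∸ i
    j<c = +-cancelˡ-≤ i (suc j) (F (1 + l) ∸ i) (≤-trans (≤-reflexive (ring i j)) (≤-trans h (≤-reflexive (sym i+c≡F))))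
      where
      ring : ∀ i j → i + (1 + j) ≡ i + j + 1
      ring = ℕ-Solver.solve-∀

  markerB : ∀ {i} → PosB i → Marker n (1 + l) i (F (2 + l) ∸ i)
  markerB {i} (lower , upper) = marker (positive j<F lower) i+c≡F
    (≤-certificate 0 (+-mono-≤ lower (≤-reflexive i+c≡F)) (ring i (F (2 + l) ∸ i) j (F (1 + l)) (F (2 + l))))
    (≤-trans (+-monoʳ-< (F (2 + l)) j<F) (m≤m+n _ _))
    where
    i+c≡F = m+[n∸m]≡n upper
    ring : ∀ i c j f g → c + f + (i + j + g) + 0 ≡ g + j + (f + (i + c))
    ring = ℕ-Solver.solve-∀

  markerC : ∀ {i} → PosC i → Marker n (2 + l) i (F (3 + l) ∸ i)
  markerC {i} (lower , upper) = marker (positive j<F₃ lower) i+c≡F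
    (≤-trans (+-monoˡ-≤ (F (2 + l)) (m≤n+o⇒m∸n≤o (F (3 + l)) i lower)) (≤-reflexive (+-comm j (F (2 + l)))))
    (≤-trans (≤-trans (+-monoʳ-< (F (2 + l)) j<F) (F-mono (3 + l))) (m≤m+n _ _))
    where i+c≡F = m+[n∸m]≡n upper

  -- The word of the later block has a unique position in a range that contains both windows, so
  -- equal words would have equal positions. The other two disjointness lemmas work alike.
  A-B-disjoint : ∀ {i i′} → PosA i → PosB i′ → w n i ≢ w n i′
  A-B-disjoint posA@(1≤i , h) posB eq
    with refl ← unique-position (markerB posB) _ 1≤i (PosA⇒≤F₃ posA) eq =
    <⇒≱ (≤-trans (≤-reflexive (+-comm 1 _)) h) (proj₁ posB)

  A-C-disjoint : ∀ {i i′} → PosA i → PosC i′ → w n i ≢ w n i′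
  A-C-disjoint posA@(1≤i , h) posC eq
    with refl ← unique-position (markerC posC) _ 1≤i (≤-trans (PosA⇒≤F₃ posA) (F-mono (3 + l))) eq =
    <⇒≱ (≤-trans (≤-reflexive (+-comm 1 _)) h)
      (≤-trans (≤-trans (F-mono (1 + l)) (F-mono (2 + l))) (proj₁ posC))

  B-C-disjoint : ∀ {i i′} → PosB i → PosC i′ → w n i ≢ w n i′
  B-C-disjoint {i} posB@(lower , i≤F) posC eq
    with refl ← unique-position (markerC posC) i (positive j<F lower) (≤-trans (PosB⇒≤F₃ posB) (F-mono (3 + l))) eq =
    <⇒≱ (+-mono-≤-< i≤F j<F) (proj₁ posC)

  -- The tower of `M-cover` that contains z, and the height in it, give the level and the offset of
  -- a marker. The position is the anchor minus the offset.
  classify : ∀ z → ∃ λ i → (PosA i ⊎ PosB i ⊎ PosC i) × win n z ≡ w n i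
  classify z with M-cover l z
  ... | inj₂ (b , b<F , m) = F (2 + l) ∸ b , inj₂ (inj₁ pos) , M⇒occurs (markerB pos) z
        (M-at (1 + l) (cong (λ x → z ℤ.+ + x) (sym (m∸[m∸n]≡n b≤F))) m)
    where
    b≤F : b ≤ F (2 + l)
    b≤F = ≤-trans (<⇒≤ b<F) (m≤n+m (F l) (F (1 + l)))
    pos : PosB (F (2 + l) ∸ b)
    pos = ≤-trans (m+n≤o⇒m≤o∸n (F (1 + l)) (+-monoʳ-≤ (F (1 + l)) (<⇒≤ b<F))) (m≤m+n _ j) , m∸n≤m _ b
  ... | inj₁ (a , a<F , m) with suc j ≤? a
  ...   | yes j<a = F (1 + l) ∸ a , inj₁ pos , M⇒occurs (markerA pos) z
        (M-at l (cong (λ x → z ℤ.+ + x) (sym (m∸[m∸n]≡n (<⇒≤ a<F)))) m)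
    where
    pos : PosA (F (1 + l) ∸ a)
    pos = m<n⇒0<n∸m a<F ,
      ≤-trans (≤-reflexive (trans (+-assoc _ j 1) (cong (λ x → F (1 + l) ∸ a + x) (+-comm j 1))))
        (≤-trans (+-monoʳ-≤ _ j<a) (≤-reflexive (m∸n+n≡m (<⇒≤ a<F))))
  -- For `a ≤ j` the window contains `F (2 + l)` letters from offset `a` on, enough to tell the two
  -- classes of `M-split` apart: the first gives C, the second gives B with offset `a + F l`.
  ...   | no  j≮a with M-split l (z ℤ.+ + a) m
  ...     | inj₁ m₂ = F (3 + l) ∸ a , inj₂ (inj₂ pos) , M⇒occurs (markerC pos) z
        (M-at (2 + l) (cong (λ x → z ℤ.+ + x) (sym (m∸[m∸n]≡n a≤F))) m₂)
    where
    a≤j : a ≤ j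
    a≤j = ≮⇒≥ j≮a
    a≤F : a ≤ F (3 + l)
    a≤F = ≤-trans a≤j (<⇒≤ j<F₃)
    pos : PosC (F (3 + l) ∸ a)
    pos = ≤-trans (≤-reflexive (sym (m∸n+n≡m a≤F))) (+-monoʳ-≤ _ a≤j) , m∸n≤m _ a
  ...     | inj₂ m₁ = F (1 + l) ∸ a , inj₂ (inj₁ pos) , M⇒occurs (markerB pos) z
        (M-at (1 + l) (trans (+-shift z a (F l) refl) (cong (λ x → z ℤ.+ + x) (sym c≡))) m₁)
    where
    a≤F : a ≤ F (1 + l)
    a≤F = <⇒≤ a<F
    pos : PosB (F (1 + l) ∸ a)
    pos = ≤-trans (≤-reflexive (sym (m∸n+n≡m a≤F))) (+-monoʳ-≤ _ (≮⇒≥ j≮a)) , ≤-trans (m∸n≤m _ a) (F-mono (1 + l))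
    c≡ : F (2 + l) ∸ (F (1 + l) ∸ a) ≡ a + F l
    c≡ = trans (cong (_∸ (F (1 + l) ∸ a)) (+-comm (F (1 + l)) (F l)))
      (trans (+-∸-assoc (F l) (m∸n≤m (F (1 + l)) a))
        (trans (cong (λ x → F l + x) (m∸[m∸n]≡n a≤F)) (+-comm (F l) a)))

  InABC : Vec ℕ n → Set
  InABC u = InA n (2 + l) j u ⊎ InB n (2 + l) j u ⊎ InC n (2 + l) j u

  InP⇒InABC : ∀ u → InP n u → InABC u
  InP⇒InABC u (z , refl) with classify z
  ... | i , inj₁ pos        , e = inj₁ (subst (InA n (2 + l) j) (sym e) (PosA⇒InA pos))
  ... | i , inj₂ (inj₁ pos) , e = inj₂ (inj₁ (subst (InB n (2 + l) j) (sym e) (PosB⇒InB pos)))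
  ... | i , inj₂ (inj₂ pos) , e = inj₂ (inj₂ (subst (InC n (2 + l) j) (sym e) (PosC⇒InC pos)))

  InABC⇒InP : ∀ u → InABC u → InP n u
  InABC⇒InP u (inj₁ (m , _ , e))        = + (1 + m) , e
  InABC⇒InP u (inj₂ (inj₁ (m , _ , e))) = + (F (1 + l) ∸ j + m) , e
  InABC⇒InP u (inj₂ (inj₂ (m , _ , e))) = + (F (3 + l) ∸ j + m) , e

  InA-InB-disjoint : ∀ u → ¬ (InA n (2 + l) j u × InB n (2 + l) j u)
  InA-InB-disjoint u (inA , inB) with i , posA , e ← InA⇒PosA inA | i′ , posB , e′ ← InB⇒PosB inB =
    A-B-disjoint posA posB (trans e (sym e′))

  InA-InC-disjoint : ∀ u → ¬ (InA n (2 + l) j u × InC n (2 + l) j u)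
  InA-InC-disjoint u (inA , inC) with i , posA , e ← InA⇒PosA inA | i′ , posC , e′ ← InC⇒PosC inC =
    A-C-disjoint posA posC (trans e (sym e′))

  InB-InC-disjoint : ∀ u → ¬ (InB n (2 + l) j u × InC n (2 + l) j u)
  InB-InC-disjoint u (inB , inC) with i , posB , e ← InB⇒PosB inB | i′ , posC , e′ ← InC⇒PosC inC =
    B-C-disjoint posB posC (trans e (sym e′))

  A-repeats : ∀ m → m + j + 2 ≤ F (1 + l) → w n (F (2 + l) + 1 + m) ≡ w n (1 + m)
  A-repeats m h = trans (cong (w n) (+-assoc (F (2 + l)) 1 m)) (second-position (markerA (posA m h)))

  -- For `i = 1 + m`, the condition that the window ends by F (l + 3) - 2 is the bound on `m` in
  -- `InA` with `F (2 + l)` added to both sides.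
  InA⇔FactorOfPrefix : ∀ u → InA n (2 + l) j u ⇔ FactorOfPrefix (F (3 + l) ∸ 2) u
  InA⇔FactorOfPrefix u = mk⇔ to from
    where
    2≤F₃ : 2 ≤ F (3 + l)
    2≤F₃ = +-mono-≤ (F-pos (2 + l)) (F-pos (1 + l))
    ring : ∀ m j f → f + (m + j + 2) ≡ m + (f + j) + 2
    ring = ℕ-Solver.solve-∀
    to : InA n (2 + l) j u → FactorOfPrefix (F (3 + l) ∸ 2) u
    to (m , h , e) = 1 + m , s≤s z≤n , m+n≤o⇒m≤o∸n (m + n)
      (≤-trans (≤-reflexive (sym (ring m j (F (2 + l))))) (+-monoʳ-≤ (F (2 + l)) h)) , e
    from : FactorOfPrefix (F (3 + l) ∸ 2) u → InA n (2 + l) j u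
    from (suc m , _ , h , e) = m , +-cancelˡ-≤ (F (2 + l)) (m + j + 2) (F (1 + l))
      (≤-trans (≤-reflexive (ring m j (F (2 + l))))
        (≤-trans (+-monoˡ-≤ 2 h) (≤-reflexive (m∸n+n≡m 2≤F₃)))) , e

  -- All positions found by `classify` are at most `F (3 + l)`. The bound is attained because the
  -- last word of C does not occur at any earlier positive position.
  f-value : IsF n (F (4 + l) + j ∸ 1)
  f-value = covers , minimal
    where
    last : PosC (F (3 + l))
    last = m≤m+n _ j , ≤-refl
    end : ∀ {i} → i ≤ F (3 + l) → i + n ∸ 1 ≤ F (4 + l) + j ∸ 1
    end i≤F = ∸-monoˡ-≤ 1 (≤-trans (+-monoˡ-≤ n i≤F) (≤-reflexive (sym (+-assoc (F (3 + l)) (F (2 + l)) j))))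
    covers : CoversP n (F (4 + l) + j ∸ 1)
    covers u (z , refl) with classify z
    ... | i , inj₁ pos        , e = i , proj₁ pos , end (PosA⇒≤F₃ pos) , sym e
    ... | i , inj₂ (inj₁ pos) , e = i , positive j<F (proj₁ pos) , end (PosB⇒≤F₃ pos) , sym e
    ... | i , inj₂ (inj₂ pos) , e = i , positive j<F₃ (proj₁ pos) , end (proj₂ pos) , sym e
    minimal : ∀ N → CoversP n N → F (4 + l) + j ∸ 1 ≤ N
    minimal N cover with i , 1≤i , i+n≤N , e ← cover (w n (F (3 + l))) (+ F (3 + l) , refl) =
      ≤-trans (∸-monoˡ-≤ 1 (≤-trans (≤-reflexive (+-assoc (F (3 + l)) (F (2 + l)) j)) (+-monoˡ-≤ n F≤i))) i+n≤N
      where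
      F≤i : F (3 + l) ≤ i
      F≤i with i ≤? F (3 + l)
      ... | no  i≰F = <⇒≤ (≰⇒> i≰F)
      ... | yes i≤F = ≤-reflexive (sym (unique-position (markerC last) i 1≤i (≤-trans i≤F (F-mono (3 + l))) e))

  -- The positions `i` and `F (2 + l) + i` lie on either side of the cut at `F (2 + l)`, and each
  -- side is counted separately.
  count-A : ∀ u → InA n (2 + l) j u → count n (F (3 + l)) u ≡ 2
  count-A u inA with i , pos , refl ← InA⇒PosA inA = trans
    (count-step (w n i) (F (2 + l)) (F (2 + l) + i) (F (3 + l))
      (m<m+n (F (2 + l)) (proj₁ pos)) (+-monoʳ-≤ (F (2 + l)) (PosA⇒≤F₁ pos)) (second-position (markerA pos))
      λ i′ F<i′ i′≤F e → [ (λ i′≡i → contradiction (≤-trans (≤-reflexive i′≡i) (PosA⇒≤F₂ pos)) (<⇒≱ F<i′)) , id ]′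
        (two-positions (markerA pos) i′ (≤-trans (s≤s z≤n) F<i′) i′≤F e))
    (cong suc (count-step (w n i) 0 i (F (2 + l)) (proj₁ pos) (PosA⇒≤F₂ pos) refl
      λ i′ 0<i′ i′≤F e → unique-position (markerA pos) i′ 0<i′ i′≤F e))

  count-BC : ∀ u → InB n (2 + l) j u ⊎ InC n (2 + l) j u → count n (F (3 + l)) u ≡ 1
  count-BC u (inj₁ inB) with i , pos , refl ← InB⇒PosB inB =
    count-step (w n i) 0 i (F (3 + l)) (positive j<F (proj₁ pos)) (PosB⇒≤F₃ pos) refl
      λ i′ 0<i′ i′≤F e → unique-position (markerB pos) i′ 0<i′ i′≤F e
  count-BC u (inj₂ inC) with i , pos , refl ← InC⇒PosC inC =
    count-step (w n i) 0 i (F (3 + l)) (positive j<F₃ (proj₁ pos)) (proj₂ pos) refl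
      λ i′ 0<i′ i′≤F e → unique-position (markerC pos) i′ 0<i′ (≤-trans i′≤F (F-mono (3 + l))) e

  repeated-window-InA : ∀ i → F (2 + l) + 1 ≤ i → i + j + 1 ≤ F (3 + l) → InA n (2 + l) j (w n i)
  repeated-window-InA i F<i h with m , refl ← m≤n⇒∃[o]m+o≡n F<i =
    m , m+j+2≤F , sym (A-repeats m m+j+2≤F)
    where
    ring : ∀ f m j → f + (m + j + 2) ≡ f + 1 + m + j + 1
    ring = ℕ-Solver.solve-∀
    m+j+2≤F : m + j + 2 ≤ F (1 + l)
    m+j+2≤F = +-cancelˡ-≤ (F (2 + l)) (m + j + 2) (F (1 + l)) (≤-trans (≤-reflexive (ring (F (2 + l)) m j)) h)

  -- Cardinalities of the blocks

  card-A : HasCard (InA n (2 + l) j) (F (1 + l) ∸ j ∸ 1)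
  card-A = range-HasCard {P = InA n (2 + l) j} 1 _ to (λ m m<c → m , bound m m<c , refl) injective
    where
    c = F (1 + l) ∸ j ∸ 1
    to : ∀ u → InA n (2 + l) j u → ∃ λ m → m < c × w n (1 + m) ≡ u
    to u (m , h , e) = m , m+n≤o⇒m≤o∸n (suc m) (m+n≤o⇒m≤o∸n (suc m + 1) (≤-trans (≤-reflexive (ring m j)) h)) , e
      where
      ring : ∀ m j → 1 + m + 1 + j ≡ m + j + 2
      ring = ℕ-Solver.solve-∀
    bound : ∀ m → m < c → m + j + 2 ≤ F (1 + l)
    bound m m<c = begin
      m + j + 2                       ≡⟨ ring m j ⟩
      j + (1 + (1 + m))               ≤⟨ +-monoʳ-≤ j (+-monoʳ-≤ 1 m<c) ⟩
      j + (1 + c)                     ≡⟨ cong (λ x → j + x) (m+[n∸m]≡n (m<n⇒0<n∸m j<F)) ⟩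
      j + (F (1 + l) ∸ j)             ≡⟨ m+[n∸m]≡n j≤F₁ ⟩
      F (1 + l)                       ∎
      where
      open ≤-Reasoning
      ring : ∀ m j → m + j + 2 ≡ j + (1 + (1 + m))
      ring = ℕ-Solver.solve-∀
    injective : ∀ m m′ → m < c → m′ < c → w n (1 + m) ≡ w n (1 + m′) → m ≡ m′
    injective m m′ m<c m′<c e = suc-injective (unique-position (markerA (posA m′ (bound m′ m′<c))) (1 + m)
      (s≤s z≤n) (PosA⇒≤F₂ (posA m (bound m m<c))) e)

  <+1⇒≤ : ∀ {m c} → m < c + 1 → m ≤ c
  <+1⇒≤ {m} {c} h = ≤-pred (≤-trans h (≤-reflexive (+-comm c 1)))

  ≤⇒<+1 : ∀ {m c} → m ≤ c → m < c + 1
  ≤⇒<+1 {m} {c} h = ≤-trans (s≤s h) (≤-reflexive (+-comm 1 c))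

  card-B : HasCard (InB n (2 + l) j) (F l + j + 1)
  card-B = range-HasCard {P = InB n (2 + l) j} (F (1 + l) ∸ j) _
    (λ _ (m , h , e) → m , ≤⇒<+1 h , e) (λ m h → m , <+1⇒≤ h , refl)
    λ m m′ m< m′< e → +-cancelˡ-≡ (F (1 + l) ∸ j) m m′ (unique-position (markerB (pos m′ m′<)) _
      (positive j<F (proj₁ (pos m m<))) (PosB⇒≤F₃ (pos m m<)) e)
    where
    pos : ∀ m → m < F l + j + 1 → PosB (F (1 + l) ∸ j + m)
    pos m m< = ∸+-lower m j≤F₁ , ∸+-upper j≤F₁ (<+1⇒≤ m<)

  card-C : HasCard (InC n (2 + l) j) (j + 1)
  card-C = range-HasCard {P = InC n (2 + l) j} (F (3 + l) ∸ j) _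
    (λ _ (m , h , e) → m , ≤⇒<+1 h , e) (λ m h → m , <+1⇒≤ h , refl)
    λ m m′ m< m′< e → +-cancelˡ-≡ (F (3 + l) ∸ j) m m′ (unique-position (markerC (pos m′ m′<)) _
      (positive j<F₃ (proj₁ (pos m m<))) (≤-trans (proj₂ (pos m m<)) (F-mono (3 + l))) e)
    where
    pos : ∀ m → m < j + 1 → PosC (F (3 + l) ∸ j + m)
    pos m m< = ∸+-lower m (<⇒≤ j<F₃) ,
      ≤-trans (∸+-upper {D = 0} (<⇒≤ j<F₃) (<+1⇒≤ m<)) (≤-reflexive (+-identityʳ _))

  -- Distances of consecutive occurrences

  distance : ∀ {x y x′ y′} (z z′ : ℤ) → x ≡ x′ → y ≡ y′ →
    z′ ≡ z ℤ.+ + x ⊎ z′ ≡ z ℤ.+ + y → z′ ≡ z ℤ.+ + x′ ⊎ z′ ≡ z ℤ.+ + y′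
  distance z z′ refl refl h = h

  n∸j≡F₂ : F (2 + l) ≡ n ∸ j
  n∸j≡F₂ = sym (m+n∸n≡m (F (2 + l)) j)

  n∸[F₀+j]≡F₁ : F (1 + l) ≡ n ∸ (F l + j)
  n∸[F₀+j]≡F₁ = sym (trans (cong (_∸ (F l + j)) (+-assoc (F (1 + l)) (F l) j)) (m+n∸n≡m (F (1 + l)) (F l + j)))

  n+x∸j≡F₂+x : ∀ x → F (2 + l) + x ≡ n + x ∸ j
  n+x∸j≡F₂+x x = sym (trans (cong (_∸ j) (ring (F (2 + l)) j x)) (m+n∸n≡m (F (2 + l) + x) j))
    where
    ring : ∀ f j x → f + j + x ≡ f + x + j
    ring = ℕ-Solver.solve-∀

  -- Occurrences form a translate of `M l`, with distances `F (1 + l)` and `F (2 + l)`, here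
  -- rewritten in `n` and `j`; the swap puts the larger one first. B and C use the next two levels.
  distance-A : ∀ u → InA n (2 + l) j u → ∀ (i i′ : ℤ) → Consecutive u i i′ →
    i′ ≡ i ℤ.+ + (n ∸ j) ⊎ i′ ≡ i ℤ.+ + (n ∸ (F l + j))
  distance-A u inA z z′ cons with i , pos , refl ← InA⇒PosA inA =
    Sum.swap (distance z z′ n∸[F₀+j]≡F₁ n∸j≡F₂ (consecutive-distance (markerA pos) z z′ cons))

  distance-B : ∀ u → InB n (2 + l) j u → ∀ (i i′ : ℤ) → Consecutive u i i′ →
    i′ ≡ i ℤ.+ + (n ∸ j) ⊎ i′ ≡ i ℤ.+ + (n + F (1 + l) ∸ j)
  distance-B u inB z z′ cons with i , pos , refl ← InB⇒PosB inB =
    distance z z′ n∸j≡F₂ (n+x∸j≡F₂+x (F (1 + l))) (consecutive-distance (markerB pos) z z′ cons)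

  distance-C : ∀ u → InC n (2 + l) j u → ∀ (i i′ : ℤ) → Consecutive u i i′ →
    i′ ≡ i ℤ.+ + (n + F (1 + l) ∸ j) ⊎ i′ ≡ i ℤ.+ + (n + F (3 + l) ∸ j)
  distance-C u inC z z′ cons with i , pos , refl ← InC⇒PosC inC =
    distance z z′ (n+x∸j≡F₂+x (F (1 + l))) (trans (+-comm (F (3 + l)) (F (2 + l))) (n+x∸j≡F₂+x (F (3 + l))))
      (consecutive-distance (markerC pos) z z′ cons)

theorem3p4 : (n k j : ℕ) → 2 ≤ n → 2 ≤ k → j < F (k ∸ 1) → n ≡ F k + j →
  -- (a)
  ((∀ (u : Vec ℕ n) → InP n u ⇔ (InA n k j u ⊎ InB n k j u ⊎ InC n k j u))
   × (∀ (u : Vec ℕ n) → ¬ (InA n k j u × InB n k j u))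
   × (∀ (u : Vec ℕ n) → ¬ (InA n k j u × InC n k j u))
   × (∀ (u : Vec ℕ n) → ¬ (InB n k j u × InC n k j u)))
  -- (b)
  × ((∀ m → m + j + 2 ≤ F (k ∸ 1) → w n (F k + 1 + m) ≡ w n (1 + m))
   × (∀ (u : Vec ℕ n) → InA n k j u ⇔ FactorOfPrefix (F (suc k) ∸ 2) u)
   × IsF n (F (suc (suc k)) + j ∸ 1)
   × (∀ (u : Vec ℕ n) → InA n k j u → count n (F (suc k)) u ≡ 2)
   × (∀ (u : Vec ℕ n) → InB n k j u ⊎ InC n k j u → count n (F (suc k)) u ≡ 1)
   × (∀ i → 1 ≤ i → i + j + 1 ≤ F (k ∸ 1) → InA n k j (w n i))
   × (∀ i → F (k ∸ 1) ≤ i + j → i ≤ F k → InB n k j (w n i))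
   × (∀ i → F k + 1 ≤ i → i + j + 1 ≤ F (suc k) → InA n k j (w n i))
   × (∀ i → F (suc k) ≤ i + j → i ≤ F (suc k) → InC n k j (w n i)))
  -- (c)
  × (HasCard (InA n k j) (F (k ∸ 1) ∸ j ∸ 1)
   × (∀ (u : Vec ℕ n) → InA n k j u → ∀ (i i′ : ℤ) → Consecutive u i i′ →
        i′ ≡ i ℤ.+ + (n ∸ j) ⊎ i′ ≡ i ℤ.+ + (n ∸ (F (k ∸ 2) + j))))
  -- (d)
  × (HasCard (InB n k j) (F (k ∸ 2) + j + 1)
   × (∀ (u : Vec ℕ n) → InB n k j u → ∀ (i i′ : ℤ) → Consecutive u i i′ →
        i′ ≡ i ℤ.+ + (n ∸ j) ⊎ i′ ≡ i ℤ.+ + (n + F (k ∸ 1) ∸ j)))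
  -- (e)
  × (HasCard (InC n k j) (j + 1)
   × (∀ (u : Vec ℕ n) → InC n k j u → ∀ (i i′ : ℤ) → Consecutive u i i′ →
        i′ ≡ i ℤ.+ + (n + F (k ∸ 1) ∸ j) ⊎ i′ ≡ i ℤ.+ + (n + F (suc k) ∸ j)))
theorem3p4 _ (suc zero) _ _ (s≤s ())
theorem3p4 _ (suc (suc l)) j _ _ j<F refl =
    ((λ u → mk⇔ (InP⇒InABC u) (InABC⇒InP u)) , InA-InB-disjoint , InA-InC-disjoint , InB-InC-disjoint)
  , (A-repeats , InA⇔FactorOfPrefix , f-value , count-A , count-BC
    , (λ i 1≤i i+j+1≤F → PosA⇒InA (1≤i , i+j+1≤F))
    , (λ i F≤i+j i≤F → PosB⇒InB (F≤i+j , i≤F))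
    , repeated-window-InA
    , (λ i F≤i+j i≤F → PosC⇒InC (F≤i+j , i≤F)))
  , (card-A , distance-A)
  , (card-B , distance-B)
  , (card-C , distance-C)
  where open Blocks l j j<F
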